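{- Let $q$ be an odd prime power, $p=\operatorname{char}\mathbb F_q$, and $d\ge1$. Suppose that $$p\mid d+2\qquad\text{and}\qquad\bigl(d\text{ is odd or }q\equiv1\pmod4\bigr).$$ Let $1\le k\le d+1$, and put $\ell=\min(k,d+2-k)$. If $\ell<p$, then the standard quadratic space $(\mathbb F_q^d,\ Q(x)=x_1^2+\cdots+x_d^2)$ contains an $\ell$-distance set of size $\binom{d+2}{k}$. In particular, if $d\ge2$, then taking $k=2$ gives a two-distance set of size $\binom{d+2}{2}$, namely the set of edge midpoints $\{(P_i+P_j)/2: 0\le i<j\le d+1\}$ of a $(d+2)$-point equilateral set $\{P_0,\ldots,P_{d+1}\}\subset\mathbb F_q^d$.
   Context: A set $S\subseteq\mathbb F_q^d$ is an $s$-distance set if $Q(x-y)$, over distinct $x,y\in S$, takes exactly $s$ values; a two-distance set is the case $s=2$. Points $P_0,\ldots,P_{d+1}$ form an equilateral set (with nonzero common squared distance) if there is $\Delta\in\mathbb F_q^*$ with $Q(P_i-P_j)=\Delta$ for all $i\ne j$. -}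

module Defs where

open import Algebra.Apartness.Structures using (IsHeytingField)
open import Algebra.Bundles using (CommutativeRing)
import Algebra.Definitions.RawMonoid as RawMonoidDefs
open import Data.Fin.Base using (Fin) renaming (_<_ to _<ᶠ_)
import Data.Fin.Properties as Fin
open import Data.Nat.Base using (ℕ; _+_; _^_; _≤_)
open import Data.Nat.Divisibility using (_∣_)
open import Data.Nat.Primality using (Prime)
open import Data.Product using (∃; ∃₂; _×_; proj₁)
open import Data.Vec.Functional using (Vector; zipWith)
import Data.Vec.Functional.Relation.Binary.Equality.Setoid as VecEquality
open import Function.Bundles using (Inverse; _⇔_)
open import Function.Properties.Inverse using (Inverse⇒Injection)
open import Level using (Level; _⊔_) renaming (suc to lsuc)
open import Relation.Binary.Bundles using (Setoid)
import Relation.Binary.Construct.On as On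
open import Relation.Binary.Definitions using (Decidable)
open import Relation.Binary.PropositionalEquality.Core using (_≡_; _≢_)
import Relation.Binary.PropositionalEquality.Properties as ≡
open import Relation.Nullary using (¬_; yes; no)
open import Relation.Nullary.Decidable using (via-injection)
open import Relation.Unary using (Pred; _∈_)

Odd : ℕ → Set
Odd n = ¬ (2 ∣ n)

PrimePower : ℕ → Set
PrimePower q = ∃₂ λ r n → Prime r × 1 ≤ n × q ≡ r ^ n

HasSize : ∀ {a ℓ} → Setoid a ℓ → ℕ → Set (a ⊔ ℓ)
HasSize S n = Inverse S (≡.setoid (Fin n))

-- A subset as a setoid: membership proofs are ignored, so elements are
-- counted up to the equality of the ambient setoid.
subsetoid : ∀ {a ℓ r} (S : Setoid a ℓ) → Pred (Setoid.Carrier S) r →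
            Setoid (a ⊔ r) ℓ
subsetoid S P = On.setoid {B = ∃ P} S proj₁

-- A field in the usual sense is a Heyting field whose apartness is ≉
-- (in particular 1# ≉ 0#, by invertible⇒#).
record FiniteField (c ℓ : Level) (q : ℕ) : Set (lsuc (c ⊔ ℓ)) where
  field
    commutativeRing : CommutativeRing c ℓ

  open CommutativeRing commutativeRing public renaming (_+_ to _⊕_)

  field
    isHeytingField : IsHeytingField _≈_ _≉_ _⊕_ _*_ -_ 0# 1#
    hasSize        : HasSize setoid q

  open IsHeytingField isHeytingField public using (#⇒invertible; invertible⇒#)

  infix 4 _≟_
  _≟_ : Decidable _≈_
  _≟_ = via-injection (Inverse⇒Injection hasSize) Fin._≟_

  -- Total, with 0# ⁻¹ = 0#.  For x ≉ 0#, #⇒invertible provides an inverse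
  -- of x - 0#, hence of x.
  infix 9 _⁻¹
  _⁻¹ : Carrier → Carrier
  x ⁻¹ with x ≟ 0#
  ... | yes _  = 0#
  ... | no x≉0 = proj₁ (#⇒invertible x≉0)

  HasCharacteristic : ℕ → Set ℓ
  HasCharacteristic p = ∀ n → (n ×ᵣ 1# ≈ 0#) ⇔ (p ∣ n)
    where open RawMonoidDefs +-rawMonoid using () renaming (_×_ to _×ᵣ_)

module QuadraticSpace {c ℓ : Level} {q : ℕ} (F : FiniteField c ℓ q) (d : ℕ) where
  open FiniteField F
  open VecEquality setoid using (≋-setoid)
  open RawMonoidDefs +-rawMonoid using (sum)

  space : Setoid c ℓ
  space = ≋-setoid d

  open Setoid space public using () renaming (Carrier to V; _≈_ to _≈ⱽ_; _≉_ to _≉ⱽ_)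

  infixl 6 _-ⱽ_
  _-ⱽ_ : V → V → V
  _-ⱽ_ = zipWith _-_

  Q : V → Carrier
  Q x = sum (λ i → x i * x i)

  midpoint : V → V → V
  midpoint = zipWith (λ a b → (1# ⊕ 1#) ⁻¹ * (a ⊕ b))

  Distances : ∀ {r} → Pred V r → Pred Carrier (c ⊔ ℓ ⊔ r)
  Distances S δ = ∃₂ λ x y → x ∈ S × y ∈ S × x ≉ⱽ y × δ ≈ Q (x -ⱽ y)

  IsDistanceSet : ∀ {r} → ℕ → Pred V r → Set (c ⊔ ℓ ⊔ r)
  IsDistanceSet s S = HasSize (subsetoid setoid (Distances S)) s

  HasCardinality : ∀ {r} → Pred V r → ℕ → Set (c ⊔ ℓ ⊔ r)
  HasCardinality S n = HasSize (subsetoid space S) n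

  IsEquilateral : ∀ {n} → Vector V n → Set (c ⊔ ℓ)
  IsEquilateral P = ∃ λ Δ → Δ ≉ 0# × (∀ i j → i ≢ j → Q (P i -ⱽ P j) ≈ Δ)

  EdgeMidpoints : ∀ {n} → Vector V n → Pred V ℓ
  EdgeMidpoints P v = ∃₂ λ i j → i <ᶠ j × v ≈ⱽ midpoint (P i) (P j)

-- Write n = d + 2, so that n ≈ 0 in F.  For an n-point equilateral set P with
-- common squared distance Δ, the subset sums v I = Σ_{i ∈ I} P i over k-subsets I
-- satisfy Q (v I - v J) = |I ∖ J| Δ, because Q (Σ cᵢ Pᵢ) = (Δ / 2) Σ cᵢ² whenever
-- Σ cᵢ = 0.  As |I ∖ J| runs over 0, …, min (k , n - k) < p, these are min (k , n - k)
-- nonzero distances; for k = 2 and scale ½ the v I are the edge midpoints.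
--
-- The equilateral set is explicit, with Δ = -2.  Choose a² + b² = -1.  The 2 × 2
-- blocks (a , b), (-b , a) give vectors f₁, …, f₂ₘ of F²ᵐ with fᵢ · fⱼ = - δᵢⱼ; let s
-- be their sum.  If d = 2m, add the points - x s and - y s, where x + y = 1 and
-- x² + y² = 0 (such x, y exist as -1 is a square).  If d = 2m + 1, add the points
-- (x - y , - z s), (y - z , - x s), (z - x , - y s) of F × F²ᵐ, where x + y + z = 1
-- and x² + y² + z² = 0, proportional to (± a , ± b , 1).

{-# OPTIONS --safe #-}
module Submission where

open import Defs
open import Algebra.Bundles using (CommutativeRing)
import Algebra.Properties.Ring as RingProperties
import Algebra.Properties.Semiring.Mult as SemiringMult
import Algebra.Properties.Semiring.Mult.TCOptimised as MultOptimised
import Algebra.Properties.Semiring.Sum as SemiringSum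
import Algebra.Solver.Ring as RingSolver
open import Algebra.Solver.Ring.AlmostCommutativeRing using (fromCommutativeRing; _-Raw-AlmostCommutative⟶_)
open import Data.Empty using (⊥-elim)
open import Data.Fin.Base as Fin using (Fin; zero; suc; toℕ; fromℕ<; punchIn)
import Data.Fin.Properties as Fin
open import Data.Maybe.Base using (map)
open import Data.Nat.Base as ℕ using (ℕ; zero; suc; z≤n; s≤s; _+_; _∸_; _≤_; _<_; _⊓_; _%_)
import Data.Nat.Properties as ℕ
open import Data.Nat.Combinatorics using (_C_)
open import Data.Nat.Divisibility using (_∣_; ∣⇒≤; divides-refl; 0∣⇒≡0; ∣-refl)
open import Data.Nat.DivMod using (%-remove-+ʳ)
open import Data.Product using (∃; ∃₂; Σ-syntax; _×_; _,_; proj₁; proj₂)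
open import Data.Sum.Base using (_⊎_; inj₁; inj₂; [_,_]′)
open import Data.Vec.Functional using (Vector)
open import Function.Base using (_∘_; id)
open import Function.Bundles using (Injection; Inverse; Equivalence)
open import Function.Construct.Symmetry using (↔-sym)
open import Function.Properties.Inverse using (Inverse⇒Injection; ↔⇒↣)
open import Level using (Level; _⊔_)
open import Relation.Binary.Bundles using (Setoid)
open import Relation.Binary.Definitions using (_Respects_; tri<; tri≈; tri>)
open import Relation.Binary.PropositionalEquality as ≡ using (_≡_; _≢_)
import Relation.Binary.Reasoning.Setoid as SetoidReasoning
open import Relation.Nullary using (yes; no; ¬?; ¬_)
open import Relation.Nullary.Decidable using (dec⇒maybe)
open import Relation.Unary using (Pred)

-- Why these values of Δ, `d` and `q`: sending `c` to Σ cᵢ Pᵢ carries the form (Δ / 2) Σ cᵢ² on the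
-- coefficient vectors of sum 0 to `Q`. Since n = 0 in F, the all-ones vector 1 has sum 0 and spans
-- the radical of this form, so n = d + 2 equidistant points identify F^d with the quotient 1^⊥ / 1.
-- Together with a hyperbolic plane this quotient makes up F^n, so its discriminant is - (Δ / 2)^n
-- up to squares, and it has to be a square. For odd `d` this forces Δ / 2 to be minus a square; for
-- even `d` it forces -1 to be a square. The choice Δ = -2 serves both cases. Existence would follow
-- from the classification of forms by dimension and discriminant. Explicit coordinates replace that
-- classification, so every distance becomes a polynomial identity modulo a few relations. The field
-- facts they rest on are proved by counting elements, without the structure of the multiplicative
-- group.

module Combinatorics where

  -- Subsets of fixed size and the sizes of their differences.

  open import Data.Fin.Properties using (+↔⊎)
  open import Data.List.Base using (List; []; _∷_; length; filter)
  open import Data.List.Membership.Propositional using (_∈_)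
  open import Data.List.Membership.Propositional.Properties using (∈-filter⁺; ∈-filter⁻)
  open import Data.List.Properties using (filter-all)
  open import Data.List.Relation.Unary.All as All using (All; []; _∷_)
  open import Data.List.Relation.Unary.Any using (here; there)
  open import Data.List.Relation.Unary.AllPairs using ([]; _∷_)
  open import Data.List.Relation.Unary.Unique.Propositional using (Unique)
  open import Data.List.Relation.Unary.Unique.Propositional.Properties using (filter⁺)
  open import Data.Nat.Base
  open import Data.Nat.Combinatorics using (k>n⇒nCk≡0; nCk≡nC[n∸k]; nCn≡1; nCk+nC[k+1]≡[n+1]C[k+1])
  open import Data.Nat.Divisibility using (_∣0; ∣m∣n⇒∣m+n)
  open import Data.Nat.Induction using (<-wellFounded)
  open import Data.Nat.Properties
  open import Data.Sum.Function.Propositional using (_⊎-↔_)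
  open import Function.Bundles using (_↔_; mk↔ₛ′)
  open import Function.Construct.Composition using (_↔-∘_)
  open import Induction.WellFounded using (Acc; acc)
  open import Relation.Binary.Definitions using (DecidableEquality)
  open import Relation.Binary.PropositionalEquality

  -- A k-element subset of Fin n.
  data Comb : ℕ → ℕ → Set where
    []   : Comb 0 0
    take : ∀ {n k} → Comb n k → Comb (suc n) (suc k)
    skip : ∀ {n k} → Comb n k → Comb (suc n) k

  skipAll : ∀ n → Comb n 0
  skipAll zero    = []
  skipAll (suc n) = skip (skipAll n)

  skipAll-unique : ∀ {n} (I : Comb n 0) → skipAll n ≡ I
  skipAll-unique []       = refl
  skipAll-unique (skip I) = cong skip (skipAll-unique I)

  comb : ∀ {n k} → k ≤ n → Comb n k
  comb {n}     {zero}  _         = skipAll n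
  comb {suc n} {suc k} (s≤s k≤n) = take (comb k≤n)

  nC0≡1 : ∀ n → n C 0 ≡ 1
  nC0≡1 n = trans (nCk≡nC[n∸k] {0} {n} z≤n) (nCn≡1 n)

  split : ∀ {n k} → Comb (suc n) (suc k) ↔ (Comb n k ⊎ Comb n (suc k))
  split = mk↔ₛ′ to from (λ { (inj₁ _) → refl ; (inj₂ _) → refl })
                        (λ { (take _) → refl ; (skip _) → refl })
    where
    to : ∀ {n k} → Comb (suc n) (suc k) → Comb n k ⊎ Comb n (suc k)
    to (take I) = inj₁ I
    to (skip I) = inj₂ I
    from : ∀ {n k} → Comb n k ⊎ Comb n (suc k) → Comb (suc n) (suc k)
    from (inj₁ I) = take I
    from (inj₂ I) = skip I

  comb↔Fin : ∀ n k → Comb n k ↔ Fin (n C k)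
  comb↔Fin n zero = subst (λ m → Comb n 0 ↔ Fin m) (sym (nC0≡1 n))
    (mk↔ₛ′ (λ _ → zero) (λ _ → skipAll n) (λ { zero → refl }) skipAll-unique)
  comb↔Fin zero (suc k) = subst (λ m → Comb 0 (suc k) ↔ Fin m) (sym (k>n⇒nCk≡0 {0} {suc k} z<s))
    (mk↔ₛ′ (λ ()) (λ ()) (λ ()) (λ ()))
  comb↔Fin (suc n) (suc k) =
    subst (λ m → Comb (suc n) (suc k) ↔ Fin m) (nCk+nC[k+1]≡[n+1]C[k+1] n k)
      (↔-sym +↔⊎ ↔-∘ ((comb↔Fin n k ⊎-↔ comb↔Fin n (suc k)) ↔-∘ split))

  ∣_∖_∣ : ∀ {n k l} → Comb n k → Comb n l → ℕ
  ∣ []     ∖ []     ∣ = 0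
  ∣ take I ∖ take J ∣ = ∣ I ∖ J ∣
  ∣ take I ∖ skip J ∣ = suc ∣ I ∖ J ∣
  ∣ skip I ∖ take J ∣ = ∣ I ∖ J ∣
  ∣ skip I ∖ skip J ∣ = ∣ I ∖ J ∣

  -- Both sides count the union of `I` and `J`. The sizes `k` and `l` may differ because the
  -- recursion drops elements that lie in only one of the two sets.
  ∖-comm-+ : ∀ {n k l} (I : Comb n k) (J : Comb n l) → ∣ I ∖ J ∣ + l ≡ ∣ J ∖ I ∣ + k
  ∖-comm-+ []       []       = refl
  ∖-comm-+ {k = suc k} {l = suc l} (take I) (take J) =
    trans (+-suc ∣ I ∖ J ∣ l) (trans (cong suc (∖-comm-+ I J)) (sym (+-suc ∣ J ∖ I ∣ k)))
  ∖-comm-+ {k = suc k} (take I) (skip J) =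
    trans (cong suc (∖-comm-+ I J)) (sym (+-suc ∣ J ∖ I ∣ k))
  ∖-comm-+ {l = suc l} (skip I) (take J) =
    trans (+-suc ∣ I ∖ J ∣ l) (cong suc (∖-comm-+ I J))
  ∖-comm-+ (skip I) (skip J) = ∖-comm-+ I J

  ∖-comm : ∀ {n k} (I J : Comb n k) → ∣ I ∖ J ∣ ≡ ∣ J ∖ I ∣
  ∖-comm I J = +-cancelʳ-≡ _ ∣ I ∖ J ∣ ∣ J ∖ I ∣ (∖-comm-+ I J)

  ∖-≤ : ∀ {n k l} (I : Comb n k) (J : Comb n l) → ∣ I ∖ J ∣ ≤ k
  ∖-≤ []       []       = z≤n
  ∖-≤ (take I) (take J) = m≤n⇒m≤1+n (∖-≤ I J)
  ∖-≤ (take I) (skip J) = s≤s (∖-≤ I J)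
  ∖-≤ (skip I) (take J) = ∖-≤ I J
  ∖-≤ (skip I) (skip J) = ∖-≤ I J

  -- The difference `I ∖ J` is disjoint from `J`, and both lie in an `n`-element set.
  ∖-+-≤ : ∀ {n k l} (I : Comb n k) (J : Comb n l) → ∣ I ∖ J ∣ + l ≤ n
  ∖-+-≤ []       []       = z≤n
  ∖-+-≤ {l = suc l} (take I) (take J) = ≤-trans (≤-reflexive (+-suc ∣ I ∖ J ∣ l)) (s≤s (∖-+-≤ I J))
  ∖-+-≤ (take I) (skip J) = s≤s (∖-+-≤ I J)
  ∖-+-≤ {l = suc l} (skip I) (take J) = ≤-trans (≤-reflexive (+-suc ∣ I ∖ J ∣ l)) (s≤s (∖-+-≤ I J))
  ∖-+-≤ (skip I) (skip J) = m≤n⇒m≤1+n (∖-+-≤ I J)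

  ∖-≤-⊓ : ∀ {n k} (I J : Comb n k) → ∣ I ∖ J ∣ ≤ k ⊓ (n ∸ k)
  ∖-≤-⊓ I J = ⊓-glb (∖-≤ I J) (m+n≤o⇒m≤o∸n ∣ I ∖ J ∣ (∖-+-≤ I J))

  ∖-self : ∀ {n k} (I : Comb n k) → ∣ I ∖ I ∣ ≡ 0
  ∖-self []       = refl
  ∖-self (take I) = ∖-self I
  ∖-self (skip I) = ∖-self I

  ∖≡0⇒≡ : ∀ {n k} (I J : Comb n k) → ∣ I ∖ J ∣ ≡ 0 → I ≡ J
  ∖≡0⇒≡ []       []       _  = refl
  ∖≡0⇒≡ (take I) (take J) eq = cong take (∖≡0⇒≡ I J eq)
  ∖≡0⇒≡ (skip I) (skip J) eq = cong skip (∖≡0⇒≡ I J eq)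
  -- Here the tail of `I` has one element more than the tail of `J`, so it cannot be contained in
  -- it.
  ∖≡0⇒≡ {k = suc k} (skip I) (take J) eq =
    ⊥-elim (m≢1+n+m k (begin
      k                     ≡⟨ cong (_+ k) eq ⟨
      ∣ I ∖ J ∣ + k         ≡⟨ ∖-comm-+ I J ⟩
      ∣ J ∖ I ∣ + suc k     ≡⟨ +-suc ∣ J ∖ I ∣ k ⟩
      suc (∣ J ∖ I ∣ + k)   ∎))
    where open ≡-Reasoning

  -- The first `t * 2` positions form `t` pairs; `I` takes the first member of each pair and `J` the
  -- second. On the remaining `m` positions the two sets share the same `a` elements.
  ∖-attained-+ : ∀ t {a m} → a ≤ m → ∃₂ λ (I J : Comb (t * 2 + m) (t + a)) → ∣ I ∖ J ∣ ≡ t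
  ∖-attained-+ zero    a≤m = comb a≤m , comb a≤m , ∖-self (comb a≤m)
  ∖-attained-+ (suc t) a≤m with I , J , eq ← ∖-attained-+ t a≤m =
    take (skip I) , skip (take J) , cong suc eq

  ∖-attained : ∀ {n k t} → t ≤ k ⊓ (n ∸ k) → k ≤ n → ∃₂ λ (I J : Comb n k) → ∣ I ∖ J ∣ ≡ t
  ∖-attained {n} {k} {t} t≤ k≤n =
    subst₂ (λ n k → ∃₂ λ (I J : Comb n k) → ∣ I ∖ J ∣ ≡ t) n≡ (m+[n∸m]≡n t≤k)
      (∖-attained-+ t {k ∸ t} {n ∸ k ∸ t + (k ∸ t)} (m≤n+m _ _))
    where
    t≤k   = m≤n⊓o⇒m≤n k (n ∸ k) t≤
    t≤n∸k = m≤n⊓o⇒m≤o k (n ∸ k) t≤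
    open ≡-Reasoning
    n≡ : t * 2 + (n ∸ k ∸ t + (k ∸ t)) ≡ n
    n≡ = begin
      t * 2 + (n ∸ k ∸ t + (k ∸ t))       ≡⟨ cong (_+ (n ∸ k ∸ t + (k ∸ t)))
                                                    (trans (*-comm t 2) (cong (t +_) (+-identityʳ t))) ⟩
      t + t + (n ∸ k ∸ t + (k ∸ t))       ≡⟨ interchange t t (n ∸ k ∸ t) (k ∸ t) ⟩
      (t + (n ∸ k ∸ t)) + (t + (k ∸ t))   ≡⟨ cong₂ _+_ (m+[n∸m]≡n t≤n∸k) (m+[n∸m]≡n t≤k) ⟩
      (n ∸ k) + k                         ≡⟨ m∸n+n≡m k≤n ⟩
      n ∎
      where open import Algebra.Properties.CommutativeSemigroup +-commutativeSemigroup using (interchange)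

  halve : ∀ n → (∃ λ m → n ≡ m * 2) ⊎ (∃ λ m → n ≡ suc (m * 2))
  halve zero = inj₁ (0 , refl)
  halve (suc n) with halve n
  ... | inj₁ (m , eq) = inj₂ (m , cong suc eq)
  ... | inj₂ (m , eq) = inj₁ (suc m , cong suc eq)

  -- Divisibility of list lengths by partition into blocks.

  module _ {a} {A : Set a} (_≟_ : DecidableEquality A) where
    open import Data.List.Membership.DecPropositional _≟_ using (_∈?_)

    remove : A → List A → List A
    remove x = filter (λ y → ¬? (y ≟ x))

    _∖∖_ : List A → List A → List A
    xs ∖∖ ys = filter (λ x → ¬? (x ∈? ys)) xs

    length-remove : ∀ {x xs} → Unique xs → x ∈ xs → length xs ≡ suc (length (remove x xs))
    length-remove {x} (x∉xs ∷ _) (here refl) with x ≟ x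
    ... | yes _  = cong (suc ∘ length) (sym (filter-all _ (All.map ≢-sym x∉xs)))
    ... | no x≢x = ⊥-elim (x≢x refl)
    length-remove {x} {y ∷ _} (y∉xs ∷ uniq) (there x∈xs) with y ≟ x
    ... | yes refl = ⊥-elim (All.lookup y∉xs x∈xs refl)
    ... | no _     = cong suc (length-remove uniq x∈xs)

    length-∖∖ : ∀ {ys xs} → Unique ys → Unique xs → (∀ {y} → y ∈ ys → y ∈ xs) →
                length xs ≡ length ys + length (xs ∖∖ ys)
    length-∖∖ {[]} {xs} _ _ _ = cong length (sym (filter-all (λ x → ¬? (x ∈? [])) (All.tabulate {xs = xs} λ _ ())))
    length-∖∖ {y ∷ ys} {xs} (y∉ys ∷ uys) uxs ys⊆xs = begin
      length xs                                       ≡⟨ length-remove uxs (ys⊆xs (here refl)) ⟩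
      suc (length (remove y xs))                      ≡⟨ cong suc (length-∖∖ uys (filter⁺ _ uxs) ys⊆) ⟩
      suc (length ys + length (remove y xs ∖∖ ys))    ≡⟨ cong (λ zs → suc (length ys + length zs)) (filters xs) ⟩
      suc (length ys + length (xs ∖∖ (y ∷ ys)))       ∎
      where
      open ≡-Reasoning
      ys⊆ : ∀ {z} → z ∈ ys → z ∈ remove y xs
      ys⊆ z∈ys = ∈-filter⁺ _ (ys⊆xs (there z∈ys)) λ { refl → All.lookup y∉ys z∈ys refl }
      filters : ∀ zs → remove y zs ∖∖ ys ≡ zs ∖∖ (y ∷ ys)
      filters [] = refl
      filters (z ∷ zs) with z ≟ y
      ... | yes _ = filters zs
      ... | no _ with z ∈? ys
      ...   | yes _ = filters zs
      ...   | no _  = cong (z ∷_) (filters zs)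

    module _ {m} (block : A → List A)
             (length-block : ∀ x → length (block x) ≡ m)
             (x∈block : ∀ x → x ∈ block x)
             (shared : ∀ {x y z} → y ∈ block x → y ∈ block z → z ∈ block x)
             where

      -- By `shared`, an entry outside `block x` has a block disjoint from `block x`. Deleting one
      -- block therefore removes exactly `m` entries and leaves a list closed under blocks. That
      -- list is not a tail of the old one, hence the well-founded recursion on length.
      blocks-∣-length : ∀ xs → Unique xs →
        (∀ {x} → x ∈ xs → Unique (block x) × (∀ {y} → y ∈ block x → y ∈ xs)) →
        m ∣ length xs
      blocks-∣-length xs uxs closed = go xs uxs closed (<-wellFounded (length xs))
        where
        go : ∀ xs → Unique xs →
          (∀ {x} → x ∈ xs → Unique (block x) × (∀ {y} → y ∈ block x → y ∈ xs)) →
          Acc _<_ (length xs) → m ∣ length xs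
        go [] _ _ _ = m ∣0
        go xs@(x ∷ _) uxs closed (acc rs) =
          subst (m ∣_) (sym len) (∣m∣n⇒∣m+n ∣-refl
            (go (xs ∖∖ block x) (filter⁺ (λ z → ¬? (z ∈? block x)) uxs) closed′ (rs shorter)))
          where
          len : length xs ≡ m + length (xs ∖∖ block x)
          len = trans (length-∖∖ (proj₁ (closed (here refl))) uxs (proj₂ (closed (here refl))))
                      (cong (_+ _) (length-block x))
          0<m : ∀ {ys} → x ∈ ys → 0 < length ys
          0<m (here _)  = z<s
          0<m (there _) = z<s
          -- The recursion needs `m` to be positive, which holds because `x` lies in its own block.
          shorter : length (xs ∖∖ block x) < length xs
          shorter = subst (length (xs ∖∖ block x) <_) (sym len)
            (m<n+m _ (subst (0 <_) (length-block x) (0<m (x∈block x))))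
          closed′ : ∀ {z} → z ∈ xs ∖∖ block x →
                    Unique (block z) × (∀ {y} → y ∈ block z → y ∈ xs ∖∖ block x)
          closed′ z∈ with z∈xs , z∉ ← ∈-filter⁻ (λ x′ → ¬? (x′ ∈? block x)) {xs = xs} z∈ =
            proj₁ (closed z∈xs) ,
            λ y∈z → ∈-filter⁺ (λ z → ¬? (z ∈? block x)) (proj₂ (closed z∈xs) y∈z)
              (λ y∈x → z∉ (shared y∈x y∈z))

    involution⇒2∣length : ∀ (f : A → A) → (∀ x → f (f x) ≡ x) → ∀ xs → Unique xs →
      (∀ {x} → x ∈ xs → x ≢ f x × f x ∈ xs) → 2 ∣ length xs
    involution⇒2∣length f ff xs uxs closed = blocks-∣-length block (λ _ → refl) (λ _ → here refl)
      shared xs uxs λ x∈xs → (proj₁ (closed x∈xs) ∷ []) ∷ [] ∷ [] , λ where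
        (here refl)         → x∈xs
        (there (here refl)) → proj₂ (closed x∈xs)
      where
      block : A → List A
      block x = x ∷ f x ∷ []
      shared : ∀ {x y z} → y ∈ block x → y ∈ block z → z ∈ block x
      shared (here refl)         (here refl)         = here refl
      shared (here refl)         (there (here refl)) = there (here (sym (ff _)))
      shared (there (here refl)) (here refl)         = there (here refl)
      shared (there (here refl)) (there (here eq))   = here (trans (sym (ff _)) (trans (cong f (sym eq)) (ff _)))

    klein⇒4∣length : ∀ (f g : A → A) → (∀ x → f (f x) ≡ x) → (∀ x → g (g x) ≡ x) →
      (∀ x → f (g x) ≡ g (f x)) → ∀ xs → Unique xs →
      (∀ {x} → x ∈ xs → (x ≢ f x × x ≢ g x × x ≢ f (g x)) × f x ∈ xs × g x ∈ xs) →
      4 ∣ length xs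
    klein⇒4∣length f g ff gg fg xs uxs closed = blocks-∣-length block (λ _ → refl) (λ _ → here refl)
      (λ y∈x y∈z → stable (∈block-sym y∈z) y∈x) xs uxs λ x∈xs → unique x∈xs , sub x∈xs
      where
      block : A → List A
      block x = x ∷ f x ∷ g x ∷ f (g x) ∷ []

      f-stable : ∀ {x y} → y ∈ block x → f y ∈ block x
      f-stable (here refl)                         = there (here refl)
      f-stable (there (here refl))                 = here (ff _)
      f-stable (there (there (here refl)))         = there (there (there (here refl)))
      f-stable (there (there (there (here refl)))) = there (there (here (ff _)))

      g-stable : ∀ {x y} → y ∈ block x → g y ∈ block x
      g-stable (here refl)                         = there (there (here refl))
      g-stable (there (here refl))                 = there (there (there (here (sym (fg _)))))
      g-stable (there (there (here refl)))         = here (gg _)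
      g-stable (there (there (there (here refl)))) = there (here (trans (sym (fg _)) (cong f (gg _))))

      stable : ∀ {x y z} → z ∈ block y → y ∈ block x → z ∈ block x
      stable (here refl)                         y∈ = y∈
      stable (there (here refl))                 y∈ = f-stable y∈
      stable (there (there (here refl)))         y∈ = g-stable y∈
      stable (there (there (there (here refl)))) y∈ = f-stable (g-stable y∈)

      ∈block-sym : ∀ {y z} → y ∈ block z → z ∈ block y
      ∈block-sym (here refl)                         = here refl
      ∈block-sym (there (here refl))                 = there (here (sym (ff _)))
      ∈block-sym (there (there (here refl)))         = there (there (here (sym (gg _))))
      ∈block-sym (there (there (there (here refl)))) =
        there (there (there (here (sym (trans (fg _) (trans (cong g (ff _)) (gg _)))))))

      unique : ∀ {x} → x ∈ xs → Unique (block x)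
      unique {x} x∈xs with closed x∈xs
      ... | (x≢fx , x≢gx , x≢fgx) , _ , gx∈xs =
        (x≢fx ∷ x≢gx ∷ x≢fgx ∷ []) ∷
        ((λ eq → x≢fgx (trans (sym (ff x)) (cong f eq))) ∷
         (λ eq → x≢gx (trans (sym (ff x)) (trans (cong f eq) (ff (g x))))) ∷ []) ∷
        -- `g x` is again in the list, where `f` moves every entry. The two inequalities before this
        -- one are the given ones translated by `f`.
        (proj₁ (proj₁ (closed gx∈xs)) ∷ []) ∷ [] ∷ []

      sub : ∀ {x y} → x ∈ xs → y ∈ block x → y ∈ xs
      sub x∈xs (here refl)                         = x∈xs
      sub x∈xs (there (here refl))                 = proj₁ (proj₂ (closed x∈xs))
      sub x∈xs (there (there (here refl)))         = proj₂ (proj₂ (closed x∈xs))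
      sub x∈xs (there (there (there (here refl)))) =
        proj₁ (proj₂ (closed (proj₂ (proj₂ (closed x∈xs)))))

open Combinatorics

-- A ring solver with integer coefficients for any commutative ring.

module IntegerCoefficients {c ℓ} (R : CommutativeRing c ℓ) where
  open import Data.Integer.Base as ℤ using (ℤ; +_; -[1+_]; _⊖_)
  import Data.Integer.Properties as ℤ
  open CommutativeRing R renaming (_+_ to _⊕_)
  open RingProperties ring
  open MultOptimised semiring using (1+×; ×-homo-+; ×1-homo-*) renaming (_×_ to _·_)
  open SetoidReasoning setoid

  -- With these multiples `1 · x` is `x` by definition, so the coefficients 1, 2 and 3 denote `1#`,
  -- `1# ⊕ 1#` and `(1# ⊕ 1#) ⊕ 1#` themselves, and solved equations match goals written with these
  -- sums.
  ⟦_⟧ : ℤ → Carrier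
  ⟦ + n ⟧      = n · 1#
  ⟦ -[1+ n ] ⟧ = - (suc n · 1#)

  ⟦⟧-neg : ∀ i → ⟦ ℤ.- i ⟧ ≈ - ⟦ i ⟧
  ⟦⟧-neg (+ zero)    = sym -0#≈0#
  ⟦⟧-neg (+ (suc n)) = refl
  ⟦⟧-neg (-[1+ n ])  = sym (-‿involutive _)

  ⟦⟧-⊖ : ∀ m n → ⟦ m ⊖ n ⟧ ≈ m · 1# - n · 1#
  ⟦⟧-⊖ m zero = sym (trans (+-congˡ -0#≈0#) (+-identityʳ _))
  ⟦⟧-⊖ zero (suc n) = sym (+-identityˡ _)
  ⟦⟧-⊖ (suc m) (suc n) = begin
    ⟦ suc m ⊖ suc n ⟧              ≡⟨ ≡.cong ⟦_⟧ (ℤ.[1+m]⊖[1+n]≡m⊖n m n) ⟩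
    ⟦ m ⊖ n ⟧                      ≈⟨ ⟦⟧-⊖ m n ⟩
    x - y                          ≈⟨ +-congˡ (+-identityˡ _) ⟨
    x ⊕ (0# - y)                   ≈⟨ +-congˡ (+-congʳ (-‿inverseʳ 1#)) ⟨
    x ⊕ ((1# - 1#) - y)            ≈⟨ +-congˡ (+-assoc _ _ _) ⟩
    x ⊕ (1# ⊕ (- 1# - y))          ≈⟨ +-assoc _ _ _ ⟨
    (x ⊕ 1#) ⊕ (- 1# - y)          ≈⟨ +-cong (+-comm _ _) (-‿+-comm 1# y) ⟩
    (1# ⊕ x) - (1# ⊕ y)            ≈⟨ +-cong (1+× m 1#) (-‿cong (1+× n 1#)) ⟨
    suc m · 1# - suc n · 1#        ∎
    where
    x = m · 1#
    y = n · 1#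

  ⟦⟧-+ : ∀ i j → ⟦ i ℤ.+ j ⟧ ≈ ⟦ i ⟧ ⊕ ⟦ j ⟧
  ⟦⟧-+ (+ m)      (+ n)      = ×-homo-+ 1# m n
  ⟦⟧-+ (+ m)      (-[1+ n ]) = ⟦⟧-⊖ m (suc n)
  ⟦⟧-+ (-[1+ m ]) (+ n)      = trans (⟦⟧-⊖ n (suc m)) (+-comm _ _)
  ⟦⟧-+ (-[1+ m ]) (-[1+ n ]) = begin
    - (suc (suc (m ℕ.+ n)) · 1#)       ≡⟨ ≡.cong (λ k → - (suc k · 1#)) (ℕ.+-suc m n) ⟨
    - ((suc m ℕ.+ suc n) · 1#)         ≈⟨ -‿cong (×-homo-+ 1# (suc m) (suc n)) ⟩
    - (suc m · 1# ⊕ suc n · 1#)        ≈⟨ -‿+-comm _ _ ⟨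
    - (suc m · 1#) - (suc n · 1#)      ∎

  ⟦⟧-*-pos : ∀ m n → ⟦ + m ℤ.* + n ⟧ ≈ ⟦ + m ⟧ * ⟦ + n ⟧
  ⟦⟧-*-pos m n = trans (reflexive (≡.cong ⟦_⟧ (≡.sym (ℤ.pos-* m n)))) (×1-homo-* m n)

  ⟦⟧-*-posˡ : ∀ m j → ⟦ + m ℤ.* j ⟧ ≈ ⟦ + m ⟧ * ⟦ j ⟧
  ⟦⟧-*-posˡ m (+ n)      = ⟦⟧-*-pos m n
  ⟦⟧-*-posˡ m (-[1+ n ]) = begin
    ⟦ + m ℤ.* -[1+ n ] ⟧               ≡⟨ ≡.cong ⟦_⟧ (ℤ.neg-distribʳ-* (+ m) (+ suc n)) ⟨
    ⟦ ℤ.- (+ m ℤ.* + suc n) ⟧          ≈⟨ ⟦⟧-neg (+ m ℤ.* + suc n) ⟩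
    - ⟦ + m ℤ.* + suc n ⟧              ≈⟨ -‿cong (⟦⟧-*-pos m (suc n)) ⟩
    - (⟦ + m ⟧ * ⟦ + suc n ⟧)          ≈⟨ -‿distribʳ-* _ _ ⟩
    ⟦ + m ⟧ * ⟦ -[1+ n ] ⟧             ∎

  ⟦⟧-* : ∀ i j → ⟦ i ℤ.* j ⟧ ≈ ⟦ i ⟧ * ⟦ j ⟧
  ⟦⟧-* (+ m)      j = ⟦⟧-*-posˡ m j
  ⟦⟧-* (-[1+ m ]) j = begin
    ⟦ -[1+ m ] ℤ.* j ⟧           ≡⟨ ≡.cong ⟦_⟧ (ℤ.neg-distribˡ-* (+ suc m) j) ⟨
    ⟦ ℤ.- (+ suc m ℤ.* j) ⟧      ≈⟨ ⟦⟧-neg (+ suc m ℤ.* j) ⟩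
    - ⟦ + suc m ℤ.* j ⟧          ≈⟨ -‿cong (⟦⟧-*-posˡ (suc m) j) ⟩
    - (⟦ + suc m ⟧ * ⟦ j ⟧)      ≈⟨ -‿distribˡ-* _ _ ⟩
    ⟦ -[1+ m ] ⟧ * ⟦ j ⟧         ∎

  homomorphism : ℤ.+-*-rawRing -Raw-AlmostCommutative⟶ fromCommutativeRing R
  homomorphism = record
    { ⟦_⟧    = ⟦_⟧
    ; +-homo = ⟦⟧-+
    ; *-homo = ⟦⟧-*
    ; -‿homo = ⟦⟧-neg
    ; 0-homo = refl
    ; 1-homo = refl
    }

  module Solver = RingSolver ℤ.+-*-rawRing (fromCommutativeRing R) homomorphism
    (λ i j → map (reflexive ∘ ≡.cong ⟦_⟧) (dec⇒maybe (i ℤ.≟ j)))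

  κ : ∀ {n} → ℕ → Solver.Polynomial n
  κ n = Solver.con (+ n)

-- Finite fields: cancellation, sums of two squares, square roots of -1.

module FieldProperties {c ℓ : Level} {q : ℕ} (F : FiniteField c ℓ q) where
  open import Data.List.Base using (List; []; _∷_; length; allFin)
  open import Data.List.Membership.Propositional using (_∈_; _∉_)
  open import Data.List.Membership.Propositional.Properties using (∈-filter⁺; ∈-filter⁻; ∈-allFin)
  open import Data.List.Properties using (length-tabulate)
  open import Data.List.Relation.Unary.All using ([]; _∷_)
  open import Data.List.Relation.Unary.Any using (here; there)
  open import Data.List.Relation.Unary.AllPairs using ([]; _∷_)
  open import Data.List.Relation.Unary.Unique.Propositional using (Unique)
  open import Data.List.Relation.Unary.Unique.Propositional.Properties using (allFin⁺; filter⁺)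
  open FiniteField F
  open RingProperties ring
  open IntegerCoefficients commutativeRing using (module Solver; κ)
  open Solver
  open Inverse hasSize using (to; from; to-cong; strictlyInverseˡ; strictlyInverseʳ)
  open SetoidReasoning setoid

  two : Carrier
  two = 1# ⊕ 1#

  to-injective : ∀ {x y} → to x ≡ to y → x ≈ y
  to-injective = Injection.injective (Inverse⇒Injection hasSize)

  ⁻¹-inverseˡ : ∀ {x} → x ≉ 0# → x ⁻¹ * x ≈ 1#
  ⁻¹-inverseˡ {x} x≉0 with x ≟ 0#
  ... | yes x≈0  = ⊥-elim (x≉0 x≈0)
  ... | no  x≉0′ with #⇒invertible x≉0′
  ...   | y , y*[x-0]≈1 , _ =
    trans (*-congˡ (sym (trans (+-congˡ -0#≈0#) (+-identityʳ x)))) y*[x-0]≈1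

  1≉0 : 1# ≉ 0#
  1≉0 = invertible⇒# (1# , 1*[1-0] , trans (*-comm _ _) 1*[1-0])
    where
    1*[1-0] : 1# * (1# - 0#) ≈ 1#
    1*[1-0] = solve 0 (κ 1 :* (κ 1 :- κ 0) := κ 1) refl

  *-cancelˡ : ∀ {x y z} → x ≉ 0# → x * y ≈ x * z → y ≈ z
  *-cancelˡ {x} {y} {z} x≉0 eq = begin
    y                 ≈⟨ unit y ⟨
    x ⁻¹ * (x * y)    ≈⟨ *-congˡ eq ⟩
    x ⁻¹ * (x * z)    ≈⟨ unit z ⟩
    z                 ∎
    where
    unit : ∀ w → x ⁻¹ * (x * w) ≈ w
    unit w = trans (sym (*-assoc _ _ _)) (trans (*-congʳ (⁻¹-inverseˡ x≉0)) (*-identityˡ w))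

  *≈0⇒≈0 : ∀ {x y} → x ≉ 0# → x * y ≈ 0# → y ≈ 0#
  *≈0⇒≈0 x≉0 eq = *-cancelˡ x≉0 (trans eq (sym (zeroʳ _)))

  *-≉0 : ∀ {x y} → x ≉ 0# → y ≉ 0# → x * y ≉ 0#
  *-≉0 x≉0 y≉0 eq = y≉0 (*≈0⇒≈0 x≉0 eq)

  sq≈0⇒≈0 : ∀ {x} → x * x ≈ 0# → x ≈ 0#
  sq≈0⇒≈0 {x} eq with x ≟ 0#
  ... | yes x≈0 = x≈0
  ... | no  x≉0 = *≈0⇒≈0 x≉0 eq

  -‿zero⇒≈ : ∀ {x y} → x - y ≈ 0# → x ≈ y
  -‿zero⇒≈ {x} {y} eq = begin
    x            ≈⟨ solve 2 (λ x y → x := (x :- y) :+ y) refl x y ⟩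
    (x - y) ⊕ y  ≈⟨ +-congʳ eq ⟩
    0# ⊕ y       ≈⟨ +-identityˡ y ⟩
    y            ∎

  ≈⇒-‿zero : ∀ {x y} → x ≈ y → x - y ≈ 0#
  ≈⇒-‿zero {x} {y} eq = trans (+-congʳ eq) (-‿inverseʳ y)

  -- Reduction modulo the ideal generated by h, with cofactor z.
  modulo : ∀ {h} → h ≈ 0# → ∀ {x y} z → x ≈ y ⊕ z * h → x ≈ y
  modulo h≈0 z eq = trans eq (trans (+-congˡ (trans (*-congˡ h≈0) (zeroʳ z))) (+-identityʳ _))

  sq≈sq⇒≈± : ∀ {x y} → x * x ≈ y * y → x ≈ y ⊎ x ≈ - y
  sq≈sq⇒≈± {x} {y} eq with (x - y) ≟ 0#
  ... | yes x-y≈0 = inj₁ (-‿zero⇒≈ x-y≈0)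
  ... | no  x-y≉0 = inj₂ (-‿zero⇒≈ (*≈0⇒≈0 x-y≉0 (begin
    (x - y) * (x - - y)  ≈⟨ solve 2 (λ x y → (x :- y) :* (x :- (:- y)) := x :* x :- y :* y) refl x y ⟩
    x * x - y * y        ≈⟨ ≈⇒-‿zero eq ⟩
    0#                   ∎)))

  from-injective : ∀ {i j} → from i ≈ from j → i ≡ j
  from-injective {i} {j} eq = ≡.trans (≡.sym (strictlyInverseˡ i)) (≡.trans (to-cong eq) (strictlyInverseˡ j))

  to-neg : ∀ {x y} → x ≈ - y → to (- x) ≡ to y
  to-neg eq = to-cong (trans (-‿cong eq) (-‿involutive _))

  from-sq : ∀ {i j} → i Fin.< j → from i * from i ≈ from j * from j → from i ≈ - from j
  from-sq i<j eq with sq≈sq⇒≈± eq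
  ... | inj₁ x≈y  = ⊥-elim (Fin.<⇒≢ i<j (from-injective x≈y))
  ... | inj₂ x≈-y = x≈-y

  -- Pigeonhole for x ↦ x² on one element of each pair {x , - x} and
  -- x ↦ - 1# - x² on the other, together with the extra value - 1#.
  -1-sumOfTwoSquares : ∃₂ λ a b → (a * a ⊕ b * b) ⊕ 1# ≈ 0#
  -1-sumOfTwoSquares with Fin.pigeonhole (ℕ.n<1+n q) value
    where
    Half : Carrier → Set
    Half x = to x Fin.≤ to (- x)
    value : Fin (suc q) → Fin q
    -- This is the value - 1 - 0². As 0 is its own negative, it falls among the elements that are
    -- squared and would be missing from the other family; adding it yields `q + 1` values.
    value zero = to (- 1#)
    value (suc i) with to (from i) Fin.≤? to (- from i)
    ... | yes _ = to (from i * from i)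
    ... | no  _ = to (- 1# - from i * from i)
  ... | zero , suc j , _ , eq with to (from j) Fin.≤? to (- from j)
  ...   | yes _ = from j , 0# , (begin
    (y * y ⊕ 0# * 0#) ⊕ 1#  ≈⟨ solve 1 (λ y → (y :* y :+ κ 0 :* κ 0) :+ κ 1 := y :* y :- (:- κ 1)) refl y ⟩
    y * y - - 1#            ≈⟨ ≈⇒-‿zero (sym (to-injective eq)) ⟩
    0#                      ∎)
    where y = from j
  -- The collision forces `y` to be 0, but 0 equals its own negative and so belongs to the elements
  -- that are squared.
  ...   | no ≰ = ⊥-elim (≰ (ℕ.≤-reflexive (≡.cong toℕ (to-cong (trans y≈0 (sym (trans (-‿cong y≈0) -0#≈0#)))))))
    where
    y = from j
    y≈0 : y ≈ 0#
    y≈0 = sq≈0⇒≈0 (begin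
      y * y                   ≈⟨ solve 1 (λ y → y :* y := (:- κ 1) :- (:- κ 1 :- y :* y)) refl y ⟩
      - 1# - (- 1# - y * y)   ≈⟨ ≈⇒-‿zero (to-injective eq) ⟩
      0#                      ∎)
  -1-sumOfTwoSquares | suc i , suc j , ℕ.s≤s i<j , eq
    with to (from i) Fin.≤? to (- from i) | to (from j) Fin.≤? to (- from j)
  ... | yes _ | no _ = from i , from j , (begin
    (x * x ⊕ y * y) ⊕ 1#      ≈⟨ solve 2 (λ x y → (x :* x :+ y :* y) :+ κ 1 :=
                                   x :* x :- (:- κ 1 :- y :* y)) refl x y ⟩
    x * x - (- 1# - y * y)    ≈⟨ ≈⇒-‿zero (to-injective eq) ⟩
    0#                        ∎)
    where
    x = from i
    y = from j
  ... | no _ | yes _ = from i , from j , (begin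
    (x * x ⊕ y * y) ⊕ 1#      ≈⟨ solve 2 (λ x y → (x :* x :+ y :* y) :+ κ 1 :=
                                   y :* y :- (:- κ 1 :- x :* x)) refl x y ⟩
    y * y - (- 1# - x * x)    ≈⟨ ≈⇒-‿zero (sym (to-injective eq)) ⟩
    0#                        ∎)
    where
    x = from i
    y = from j
  -- A collision inside one family makes the two elements negatives of each other. The order on
  -- indices then separates them into different families unless they coincide; the next case is the
  -- same argument for the other family.
  ... | yes x≤-x | yes y≤-y = ⊥-elim (ℕ.<-irrefl
    (≡.cong toℕ (from-injective (to-injective (Fin.≤-antisym x≤y y≤x)))) i<j)
    where
    x≈-y = from-sq i<j (to-injective eq)
    x≤y = ≡.subst (to (from i) Fin.≤_) (to-neg x≈-y) x≤-x
    y≤x = ≡.subst (to (from j) Fin.≤_) (≡.sym (to-cong x≈-y)) y≤-y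
  ... | no x≰-x | no y≰-y = ⊥-elim (x≰-x (≡.subst (to (from i) Fin.≤_) (≡.sym (to-neg x≈-y)) (ℕ.<⇒≤ x<y)))
    where
    x≈-y = from-sq i<j (-‿injective (+-cancelˡ (- 1#) _ _ (to-injective eq)))
    x<y : to (from i) Fin.< to (from j)
    x<y = ≡.subst (Fin._< to (from j)) (≡.sym (to-cong x≈-y)) (ℕ.≰⇒> y≰-y)

  -- If 1 + 1 were 0, then adding 1 would be an involution of the field without fixed points, and
  -- `q` would be even.
  two≉0 : Odd q → two ≉ 0#
  two≉0 q-odd two≈0 = q-odd (≡.subst (2 ∣_) (length-tabulate {n = q} id)
    (involution⇒2∣length Fin._≟_ shift shift-involutive (allFin q) (allFin⁺ q)
      λ {i} _ → shift-free i , ∈-allFin (shift i)))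
    where
    shift : Fin q → Fin q
    shift i = to (from i ⊕ 1#)
    shift-involutive : ∀ i → shift (shift i) ≡ i
    shift-involutive i = ≡.trans (to-cong (begin
      from (shift i) ⊕ 1#  ≈⟨ +-congʳ (strictlyInverseʳ _) ⟩
      (from i ⊕ 1#) ⊕ 1#   ≈⟨ +-assoc _ _ _ ⟩
      from i ⊕ two         ≈⟨ +-congˡ two≈0 ⟩
      from i ⊕ 0#          ≈⟨ +-identityʳ _ ⟩
      from i               ∎)) (strictlyInverseˡ i)
    shift-free : ∀ i → i ≢ shift i
    shift-free i eq = 1≉0 (+-cancelˡ (from i) _ _ (begin
      from i ⊕ 1#     ≈⟨ strictlyInverseʳ _ ⟨
      from (shift i)  ≡⟨ ≡.cong from eq ⟨
      from i          ≈⟨ +-identityʳ _ ⟨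
      from i ⊕ 0#     ∎))

  x≈-x⇒x≈0 : two ≉ 0# → ∀ {x} → x ≈ - x → x ≈ 0#
  x≈-x⇒x≈0 two≉0 {x} eq = *≈0⇒≈0 two≉0 (begin
    two * x   ≈⟨ solve 1 (λ x → κ 2 :* x := x :- (:- x)) refl x ⟩
    x - - x   ≈⟨ ≈⇒-‿zero eq ⟩
    0#        ∎)

  ⁻¹-zero : ∀ {x} → x ≈ 0# → x ⁻¹ ≈ 0#
  ⁻¹-zero {x} x≈0 with x ≟ 0#
  ... | yes _   = refl
  ... | no  x≉0 = ⊥-elim (x≉0 x≈0)

  ⁻¹-unique : ∀ {x y} → x * y ≈ 1# → x ⁻¹ ≈ y
  ⁻¹-unique {x} {y} xy≈1 = *-cancelˡ x≉0 (trans (*-comm _ _) (trans (⁻¹-inverseˡ x≉0) (sym xy≈1)))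
    where
    x≉0 : x ≉ 0#
    x≉0 x≈0 = 1≉0 (trans (sym xy≈1) (trans (*-congʳ x≈0) (zeroˡ y)))

  ⁻¹-inverseʳ : ∀ {x} → x ≉ 0# → x * x ⁻¹ ≈ 1#
  ⁻¹-inverseʳ x≉0 = trans (*-comm _ _) (⁻¹-inverseˡ x≉0)

  -- Case analysis on x ≟ 0# itself would also rewrite inside _⁻¹.
  zero? : ∀ x → x ≈ 0# ⊎ x ≉ 0#
  zero? x with x ≟ 0#
  ... | yes x≈0 = inj₁ x≈0
  ... | no  x≉0 = inj₂ x≉0

  ⁻¹-cong : ∀ {x y} → x ≈ y → x ⁻¹ ≈ y ⁻¹
  ⁻¹-cong {x} {y} x≈y with zero? y
  ... | inj₁ y≈0 = trans (⁻¹-zero (trans x≈y y≈0)) (sym (⁻¹-zero y≈0))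
  ... | inj₂ y≉0 = ⁻¹-unique (trans (*-congʳ x≈y) (⁻¹-inverseʳ y≉0))

  ⁻¹-involutive : ∀ x → (x ⁻¹) ⁻¹ ≈ x
  ⁻¹-involutive x with zero? x
  ... | inj₁ x≈0 = trans (⁻¹-zero (⁻¹-zero x≈0)) (sym x≈0)
  ... | inj₂ x≉0 = ⁻¹-unique (⁻¹-inverseˡ x≉0)

  -‿⁻¹-comm : ∀ x → - (x ⁻¹) ≈ (- x) ⁻¹
  -‿⁻¹-comm x with zero? x
  ... | inj₁ x≈0 = begin
    - (x ⁻¹)   ≈⟨ -‿cong (⁻¹-zero x≈0) ⟩
    - 0#       ≈⟨ -0#≈0# ⟩
    0#         ≈⟨ ⁻¹-zero (trans (-‿cong x≈0) -0#≈0#) ⟨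
    (- x) ⁻¹   ∎
  ... | inj₂ x≉0 = sym (⁻¹-unique (trans
    (solve 2 (λ x y → (:- x) :* (:- y) := x :* y) refl x (x ⁻¹)) (⁻¹-inverseʳ x≉0)))

  -- When -1 is not a square, x ↦ - x and x ↦ x ⁻¹ generate a Klein four-group
  -- acting freely on the elements other than 0, 1 and -1, so 4 ∣ q - 3.
  -1-square : Odd q → q % 4 ≡ 1 → ∃ λ x → x * x ⊕ 1# ≈ 0#
  -1-square q-odd q%4≡1 with Fin.any? (λ i → from i * from i ⊕ 1# ≟ 0#)
  ... | yes (i , eq) = from i , eq
  ... | no ¬square   = ⊥-elim (contra (klein⇒4∣length Fin._≟_ neg inv neg-neg inv-inv neg-inv
    others (filter⁺ _ (allFin⁺ q)) λ {i} i∈ → free i∈ ,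
      -- An involution that maps `fixed` into itself also maps the complement into itself.
      stable i (neg i) (λ ∈fixed → ≡.subst (_∈ fixed) (neg-neg i) (neg-fixed ∈fixed)) i∈ ,
      stable i (inv i) (λ ∈fixed → ≡.subst (_∈ fixed) (inv-inv i) (inv-fixed ∈fixed)) i∈))
    where
    open import Data.List.Membership.DecPropositional (Fin._≟_ {q}) using (_∈?_)

    neg inv : Fin q → Fin q
    neg i = to (- from i)
    inv i = to (from i ⁻¹)

    neg-neg : ∀ i → neg (neg i) ≡ i
    neg-neg i = ≡.trans (to-cong (trans (-‿cong (strictlyInverseʳ _)) (-‿involutive _))) (strictlyInverseˡ i)
    inv-inv : ∀ i → inv (inv i) ≡ i
    inv-inv i = ≡.trans (to-cong (trans (⁻¹-cong (strictlyInverseʳ _)) (⁻¹-involutive _))) (strictlyInverseˡ i)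
    neg-inv : ∀ i → neg (inv i) ≡ inv (neg i)
    neg-inv i = to-cong (trans (-‿cong (strictlyInverseʳ _))
      (trans (-‿⁻¹-comm (from i)) (⁻¹-cong (sym (strictlyInverseʳ _)))))

    fixed others : List (Fin q)
    fixed  = to 0# ∷ to 1# ∷ to (- 1#) ∷ []
    others = _∖∖_ Fin._≟_ (allFin q) fixed

    1*1 : 1# * 1# ≈ 1#
    1*1 = *-identityˡ 1#
    -1*-1 : - 1# * - 1# ≈ 1#
    -1*-1 = solve 0 (:- κ 1 :* :- κ 1 := κ 1) refl

    neg-fixed : ∀ {i} → i ∈ fixed → neg i ∈ fixed
    neg-fixed (here ≡.refl)                 = here (to-cong (trans (-‿cong (strictlyInverseʳ _)) -0#≈0#))
    neg-fixed (there (here ≡.refl))         = there (there (here (to-cong (-‿cong (strictlyInverseʳ _)))))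
    neg-fixed (there (there (here ≡.refl))) =
      there (here (to-cong (trans (-‿cong (strictlyInverseʳ _)) (-‿involutive _))))

    inv-fixed : ∀ {i} → i ∈ fixed → inv i ∈ fixed
    inv-fixed (here ≡.refl)                 = here (to-cong (⁻¹-zero (strictlyInverseʳ _)))
    inv-fixed (there (here ≡.refl))         =
      there (here (to-cong (trans (⁻¹-cong (strictlyInverseʳ _)) (⁻¹-unique 1*1))))
    inv-fixed (there (there (here ≡.refl))) =
      there (there (here (to-cong (trans (⁻¹-cong (strictlyInverseʳ _)) (⁻¹-unique -1*-1)))))

    ∉fixed : ∀ {i} → i ∈ others → i ∉ fixed
    ∉fixed i∈ = proj₂ (∈-filter⁻ (λ i → ¬? (i ∈? fixed)) {xs = allFin q} i∈)

    stable : ∀ i j → (j ∈ fixed → i ∈ fixed) → i ∈ others → j ∈ others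
    stable i j back i∈ = ∈-filter⁺ (λ i → ¬? (i ∈? fixed)) (∈-allFin j) (∉fixed i∈ ∘ back)

    ≈⇒≡ : ∀ {i x} → from i ≈ x → i ≡ to x
    ≈⇒≡ {i} eq = ≡.trans (≡.sym (strictlyInverseˡ i)) (to-cong eq)
    ≡⇒≈ : ∀ {i x} → i ≡ to x → from i ≈ x
    ≡⇒≈ eq = trans (reflexive (≡.cong from eq)) (strictlyInverseʳ _)

    free : ∀ {i} → i ∈ others → i ≢ neg i × i ≢ inv i × i ≢ neg (inv i)
    free {i} i∈ =
      (λ eq → x≉0 (x≈-x⇒x≈0 (two≉0 q-odd) (≡⇒≈ eq))) ,
      (λ eq → [ (λ x≈1 → ∉fixed i∈ (there (here (≈⇒≡ x≈1)))) ,
                (λ x≈-1 → ∉fixed i∈ (there (there (here (≈⇒≡ x≈-1))))) ]′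
        (sq≈sq⇒≈± (trans (*-congˡ (≡⇒≈ eq)) (trans (⁻¹-inverseʳ x≉0) (sym 1*1))))) ,
      -- A fixed point of `x` ↦ - `x ⁻¹` is a square root of -1.
      (λ eq → ¬square (i , (begin
        x * x ⊕ 1#           ≈⟨ +-congʳ (*-congˡ (trans (≡⇒≈ eq) (-‿cong (strictlyInverseʳ _)))) ⟩
        x * - (x ⁻¹) ⊕ 1#    ≈⟨ +-congʳ (-‿distribʳ-* _ _) ⟨
        - (x * x ⁻¹) ⊕ 1#    ≈⟨ +-congʳ (-‿cong (⁻¹-inverseʳ x≉0)) ⟩
        - 1# ⊕ 1#            ≈⟨ -‿inverseˡ 1# ⟩
        0#                   ∎)))
      where
      x = from i
      x≉0 : x ≉ 0#
      x≉0 x≈0 = ∉fixed i∈ (here (≈⇒≡ x≈0))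

    -1≉0 : - 1# ≉ 0#
    -1≉0 eq = 1≉0 (trans (sym (-‿involutive 1#)) (trans (-‿cong eq) -0#≈0#))

    fixed-unique : Unique fixed
    fixed-unique =
      ((1≉0 ∘ sym ∘ to-injective) ∷ (-1≉0 ∘ sym ∘ to-injective) ∷ []) ∷
      ((1≉0 ∘ x≈-x⇒x≈0 (two≉0 q-odd) ∘ to-injective) ∷ []) ∷ [] ∷ []

    q≡3+ : q ≡ 3 ℕ.+ length others
    q≡3+ = ≡.trans (≡.sym (length-tabulate {n = q} id))
      (length-∖∖ Fin._≟_ fixed-unique (allFin⁺ q) (λ {i} _ → ∈-allFin i))

    contra : ¬ (4 ∣ length others)
    contra 4∣ with () ← ≡.trans (≡.sym (%-remove-+ʳ 3 4∣)) (≡.trans (≡.cong (_% 4) (≡.sym q≡3+)) q%4≡1)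

-- Counts a subset enumerated by an injective family. It serves for sets of points and for sets of
-- distances alike.
image-hasSize : ∀ {a ℓ r} (S : Setoid a ℓ) (P : Pred (Setoid.Carrier S) r) {m} →
  let open Setoid S in (w : Fin m → Carrier) → (∀ {i j} → w i ≈ w j → i ≡ j) → (∀ i → P (w i)) →
  (∀ {x} → P x → ∃ λ i → x ≈ w i) → HasSize (subsetoid S P) m
image-hasSize S P w w-injective P∘w index = record
  { to        = λ (_ , Px) → proj₁ (index Px)
  ; from      = λ i → w i , P∘w i
  ; to-cong   = λ {(_ , Px)} {(_ , Py)} x≈y →
      w-injective (trans (sym (proj₂ (index Px))) (trans x≈y (proj₂ (index Py))))
  ; from-cong = λ { ≡.refl → refl }
  ; inverse   = (λ {i} {(_ , Px)} x≈wi → w-injective (trans (sym (proj₂ (index Px))) x≈wi))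
              , (λ { {(_ , Px)} ≡.refl → sym (proj₂ (index Px)) })
  }
  where open Setoid S

-- The form `Q` and the explicit equilateral sets.

module Geometry {c ℓ : Level} {q : ℕ} (F : FiniteField c ℓ q) where
  open FiniteField F hiding (zero)
  open FieldProperties F
  open IntegerCoefficients commutativeRing using (module Solver; κ)
  open Solver
  open RingProperties ring
  open SemiringMult semiring using (×-homo-+; ×-assoc-*; ×-comm-*; ×-congˡ; ×-congʳ) renaming (_×_ to _·_)
  open SemiringSum semiring using
    ( sum; sum-cong-≋; sum-remove; sum-replicate-zero
    ; ∑-comm; ∑-distrib-+; *-distribˡ-sum; *-distribʳ-sum)
  open SetoidReasoning setoid
  open import Data.Vec.Functional using (_∷_; replicate)
  private
    open module Space {d} = QuadraticSpace F d

  0ⱽ : ∀ {d} → V {d}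
  0ⱽ = replicate _ 0#

  Q-cong : ∀ {d} {x y : V {d}} → x ≈ⱽ y → Q x ≈ Q y
  Q-cong x≈y = sum-cong-≋ (λ i → *-cong (x≈y i) (x≈y i))

  Q-0 : ∀ d → Q (0ⱽ {d}) ≈ 0#
  Q-0 d = trans (sum-cong-≋ {d} (λ _ → zeroˡ 0#)) (sum-replicate-zero d)

  Q-subʳ-0 : ∀ {d} (x : V {d}) → Q (x -ⱽ 0ⱽ) ≈ Q x
  Q-subʳ-0 x = Q-cong (λ i → trans (+-congˡ -0#≈0#) (+-identityʳ (x i)))

  Q-sub-comm : ∀ {d} (x y : V {d}) → Q (x -ⱽ y) ≈ Q (y -ⱽ x)
  Q-sub-comm x y = sum-cong-≋ λ i →
    solve 2 (λ x y → (x :- y) :* (x :- y) := (y :- x) :* (y :- x)) refl (x i) (y i)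

  Q-scale : ∀ {d} s (x : V {d}) → Q (λ i → s * x i) ≈ (s * s) * Q x
  Q-scale s x = trans
    (sum-cong-≋ λ i → solve 2 (λ s x → (s :* x) :* (s :* x) := (s :* s) :* (x :* x)) refl s (x i))
    (sym (*-distribˡ-sum (s * s) (λ i → x i * x i)))

  -- Both equations have the shape `h ≈ 0#` so that each can be used as a modulus in `modulo`. The
  -- conditions are invariant under cyclic shifts.
  IsotropicTriple : Carrier → Carrier → Carrier → Set ℓ
  IsotropicTriple x y z = (x ⊕ y ⊕ z) - 1# ≈ 0# × x * x ⊕ y * y ⊕ z * z ≈ 0#

  rotate : ∀ {x y z} → IsotropicTriple x y z → IsotropicTriple y z x
  rotate {x} {y} {z} (sum≈1 , sq≈0) =
    trans (solve 3 (λ x y z → (y :+ z :+ x) :- κ 1 := (x :+ y :+ z) :- κ 1) refl x y z) sum≈1 ,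
    trans (solve 3 (λ x y z → y :* y :+ z :* z :+ x :* x := x :* x :+ y :* y :+ z :* z) refl x y z) sq≈0

  dim : ℕ → Carrier
  dim m = (m ℕ.* 2) · 1#

  module NegativeFrame (a b : Carrier) (a²+b²+1≈0 : (a * a ⊕ b * b) ⊕ 1# ≈ 0#) where

    frame : ∀ m → Vector (V {m ℕ.* 2}) (m ℕ.* 2)
    frame (suc m) zero          = a ∷ b ∷ 0ⱽ
    frame (suc m) (suc zero)    = - b ∷ a ∷ 0ⱽ
    frame (suc m) (suc (suc i)) = 0# ∷ 0# ∷ frame m i

    frameSum : ∀ m → V {m ℕ.* 2}
    frameSum (suc m) = a - b ∷ a ⊕ b ∷ frameSum m

    -- All frame vectors have the same norm and the same product with their sum s, so every point on
    -- the line of s is equidistant from them.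
    apex : ∀ m → Carrier → V {m ℕ.* 2}
    apex m α i = α * frameSum m i

    Q-frame : ∀ m i → Q (frame m i) ≈ - 1#
    Q-frame (suc m) zero = trans (+-congˡ (+-congˡ (Q-0 (m ℕ.* 2)))) (modulo a²+b²+1≈0 1#
      (solve 2 (λ a b → a :* a :+ (b :* b :+ κ 0) :=
        :- κ 1 :+ κ 1 :* ((a :* a :+ b :* b) :+ κ 1)) refl a b))
    Q-frame (suc m) (suc zero) = trans (+-congˡ (+-congˡ (Q-0 (m ℕ.* 2)))) (modulo a²+b²+1≈0 1#
      (solve 2 (λ a b → (:- b) :* (:- b) :+ (a :* a :+ κ 0) :=
        :- κ 1 :+ κ 1 :* ((a :* a :+ b :* b) :+ κ 1)) refl a b))
    Q-frame (suc m) (suc (suc i)) = trans (+-congˡ (+-congˡ (Q-frame m i)))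
      (solve 0 (κ 0 :* κ 0 :+ (κ 0 :* κ 0 :+ :- κ 1) := :- κ 1) refl)

    Q-frameSum : ∀ m → Q (frameSum m) ≈ - dim m
    Q-frameSum zero    = sym -0#≈0#
    Q-frameSum (suc m) = trans (+-congˡ (+-congˡ (Q-frameSum m))) (modulo a²+b²+1≈0 two
      (solve 3 (λ a b n → (a :- b) :* (a :- b) :+ ((a :+ b) :* (a :+ b) :- n) :=
        :- (κ 1 :+ (κ 1 :+ n)) :+
        κ 2 :* ((a :* a :+ b :* b) :+ κ 1)) refl a b (dim m)))

    Q-apex : ∀ m α → Q (apex m α) ≈ - (dim m * (α * α))
    Q-apex m α = trans (Q-scale α (frameSum m)) (trans (*-congˡ (Q-frameSum m))
      (solve 2 (λ α n → (α :* α) :* (:- n) := :- (n :* (α :* α))) refl α (dim m)))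

    Q-apex-apex : ∀ m α β → Q (apex m α -ⱽ apex m β) ≈ - (dim m * ((α - β) * (α - β)))
    Q-apex-apex m α β = trans (Q-cong λ i →
      solve 3 (λ α β s → α :* s :- β :* s := (α :- β) :* s) refl α β (frameSum m i)) (Q-apex m (α - β))

    -- Each frame vector has product -1 with the sum of the frame, whence the cross term + 2α; the
    -- norms are those of `Q-apex` and `Q-frame`.
    Q-apex-frame : ∀ m α i → Q (apex m α -ⱽ frame m i) ≈ (- (dim m * (α * α)) ⊕ two * α) - 1#
    Q-apex-frame (suc m) α zero = trans
      (+-congˡ (+-congˡ (trans (Q-subʳ-0 (apex m α)) (Q-apex m α))))
      -- The first two coordinates contribute (2α² - 2α + 1)(a² + b²), which supplies the cofactor.
      (modulo a²+b²+1≈0 ((two * α) * α - two * α ⊕ 1#) (solve 4 (λ a b n α →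
        (α :* (a :- b) :- a) :* (α :* (a :- b) :- a) :+
          ((α :* (a :+ b) :- b) :* (α :* (a :+ b) :- b) :- n :* (α :* α)) :=
        ((:- ((κ 1 :+ (κ 1 :+ n)) :* (α :* α)) :+ κ 2 :* α) :- κ 1) :+
        ((κ 2 :* α) :* α :- κ 2 :* α :+ κ 1) :*
          ((a :* a :+ b :* b) :+ κ 1)) refl a b (dim m) α))
    Q-apex-frame (suc m) α (suc zero) = trans
      (+-congˡ (+-congˡ (trans (Q-subʳ-0 (apex m α)) (Q-apex m α))))
      (modulo a²+b²+1≈0 ((two * α) * α - two * α ⊕ 1#) (solve 4 (λ a b n α →
        (α :* (a :- b) :- (:- b)) :* (α :* (a :- b) :- (:- b)) :+
          ((α :* (a :+ b) :- a) :* (α :* (a :+ b) :- a) :- n :* (α :* α)) :=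
        ((:- ((κ 1 :+ (κ 1 :+ n)) :* (α :* α)) :+ κ 2 :* α) :- κ 1) :+
        ((κ 2 :* α) :* α :- κ 2 :* α :+ κ 1) :*
          ((a :* a :+ b :* b) :+ κ 1)) refl a b (dim m) α))
    Q-apex-frame (suc m) α (suc (suc i)) = trans (+-congˡ (+-congˡ (Q-apex-frame m α i)))
      (modulo a²+b²+1≈0 ((two * α) * α) (solve 4 (λ a b n α →
        (α :* (a :- b) :- κ 0) :* (α :* (a :- b) :- κ 0) :+
          ((α :* (a :+ b) :- κ 0) :* (α :* (a :+ b) :- κ 0) :+
          ((:- (n :* (α :* α)) :+ κ 2 :* α) :- κ 1)) :=
        ((:- ((κ 1 :+ (κ 1 :+ n)) :* (α :* α)) :+ κ 2 :* α) :- κ 1) :+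
        ((κ 2 :* α) :* α) :*
          ((a :* a :+ b :* b) :+ κ 1)) refl a b (dim m) α))

    Q-frame-frame : ∀ m {i j} → i Fin.< j → Q (frame m i -ⱽ frame m j) ≈ - two
    Q-frame-frame (suc m) {zero} {suc zero} _ = trans
      (+-congˡ (+-congˡ (trans (Q-subʳ-0 {m ℕ.* 2} 0ⱽ) (Q-0 (m ℕ.* 2)))))
      (modulo a²+b²+1≈0 two (solve 2 (λ a b →
        (a :- (:- b)) :* (a :- (:- b)) :+ ((b :- a) :* (b :- a) :+ κ 0) :=
        :- κ 2 :+
        κ 2 :* ((a :* a :+ b :* b) :+ κ 1)) refl a b))
    Q-frame-frame (suc m) {zero} {suc (suc j)} _ = trans
      (+-congˡ (+-congˡ (trans (Q-sub-comm 0ⱽ (frame m j)) (trans (Q-subʳ-0 (frame m j)) (Q-frame m j)))))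
      (modulo a²+b²+1≈0 1# (solve 2 (λ a b →
        (a :- κ 0) :* (a :- κ 0) :+ ((b :- κ 0) :* (b :- κ 0) :- κ 1) :=
        :- κ 2 :+ κ 1 :* ((a :* a :+ b :* b) :+ κ 1)) refl a b))
    Q-frame-frame (suc m) {suc zero} {suc (suc j)} _ = trans
      (+-congˡ (+-congˡ (trans (Q-sub-comm 0ⱽ (frame m j)) (trans (Q-subʳ-0 (frame m j)) (Q-frame m j)))))
      (modulo a²+b²+1≈0 1# (solve 2 (λ a b →
        (:- b :- κ 0) :* (:- b :- κ 0) :+ ((a :- κ 0) :* (a :- κ 0) :- κ 1) :=
        :- κ 2 :+ κ 1 :* ((a :* a :+ b :* b) :+ κ 1)) refl a b))
    Q-frame-frame (suc m) {suc zero} {suc zero} (s≤s ())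
    Q-frame-frame (suc m) {suc (suc i)} {suc zero} (s≤s ())
    Q-frame-frame (suc m) {suc (suc i)} {suc (suc j)} (s≤s (s≤s i<j)) =
      trans (+-congˡ (+-congˡ (Q-frame-frame m i<j)))
      (solve 0 ((κ 0 :- κ 0) :* (κ 0 :- κ 0) :+
        ((κ 0 :- κ 0) :* (κ 0 :- κ 0) :- κ 2) :=
        :- κ 2) refl)

  equilateral-< : ∀ {d n} (P : Vector (V {d}) n) {Δ} → Δ ≉ 0# →
    (∀ {i j} → i Fin.< j → Q (P i -ⱽ P j) ≈ Δ) → IsEquilateral P
  equilateral-< P {Δ} Δ≉0 dist = Δ , Δ≉0 , λ i j i≢j → all i j i≢j (Fin.<-cmp i j)
    where
    all : ∀ i j → i ≢ j → _ → Q (P i -ⱽ P j) ≈ Δ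
    all i j i≢j (tri< i<j _ _) = dist i<j
    all i j i≢j (tri≈ _ i≡j _) = ⊥-elim (i≢j i≡j)
    all i j i≢j (tri> _ _ j<i) = trans (Q-sub-comm (P i) (P j)) (dist j<i)

  module Simplex (two≉0 : two ≉ 0#) (a b : Carrier) (a²+b²+1≈0 : (a * a ⊕ b * b) ⊕ 1# ≈ 0#) where
    open NegativeFrame a b a²+b²+1≈0

    -two≉0 : - two ≉ 0#
    -two≉0 eq = two≉0 (trans (sym (-‿involutive two)) (trans (-‿cong eq) -0#≈0#))

    -- Since `dim m` is -2, the apex with parameter - x has squared distance 2x² - 2x - 1 from the
    -- frame. This is -2 exactly when 2x² - 2x + 1 = 0, and the two roots of that equation have sum
    -- 1 and product 1/2, that is, sum of squares 0.
    evenSimplex : ∀ m {x y} → dim m ⊕ two ≈ 0# → (x ⊕ y) - 1# ≈ 0# → x * x ⊕ y * y ≈ 0# →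
      Σ[ P ∈ Vector (V {m ℕ.* 2}) (2 ℕ.+ m ℕ.* 2) ] IsEquilateral P
    evenSimplex m {x} {y} dim+2≈0 x+y-1≈0 x²+y²≈0 = P , equilateral-< P -two≉0 dist
      where
      P : Vector (V {m ℕ.* 2}) (2 ℕ.+ m ℕ.* 2)
      P = apex m (- x) ∷ apex m (- y) ∷ frame m

      apex-frame : ∀ {x y} i → (x ⊕ y) - 1# ≈ 0# → x * x ⊕ y * y ≈ 0# →
        Q (apex m (- x) -ⱽ frame m i) ≈ - two
      apex-frame {x} {y} i x+y-1≈0 x²+y²≈0 = begin
        Q (apex m (- x) -ⱽ frame m i)
          ≈⟨ Q-apex-frame m (- x) i ⟩
        (- (dim m * (- x * - x)) ⊕ two * - x) - 1#
          ≈⟨ modulo dim+2≈0 (- (x * x)) (solve 2 (λ x n →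
               ((:- (n :* ((:- x) :* (:- x))) :+ κ 2 :* (:- x)) :- κ 1) :=
               (κ 2 :* (x :* x) :- κ 2 :* x :- κ 1) :+
               (:- (x :* x)) :* (n :+ κ 2)) refl x (dim m)) ⟩
        two * (x * x) - two * x - 1#
          ≈⟨ modulo x²+y²≈0 1# (solve 2 (λ x y →
               κ 2 :* (x :* x) :- κ 2 :* x :- κ 1 :=
               (x :* x :- y :* y :- κ 2 :* x :- κ 1) :+
               κ 1 :* (x :* x :+ y :* y)) refl x y) ⟩
        x * x - y * y - two * x - 1#
          ≈⟨ modulo x+y-1≈0 (x - y - 1#) (solve 2 (λ x y →
               x :* x :- y :* y :- κ 2 :* x :- κ 1 :=
               (:- κ 2) :+
               (x :- y :- κ 1) :* ((x :+ y) :- κ 1)) refl x y) ⟩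
        - two ∎

      dist : ∀ {i j} → i Fin.< j → Q (P i -ⱽ P j) ≈ - two
      dist {zero} {suc zero} _ = begin
        Q (apex m (- x) -ⱽ apex m (- y))
          ≈⟨ Q-apex-apex m (- x) (- y) ⟩
        - (dim m * ((- x - - y) * (- x - - y)))
          ≈⟨ modulo dim+2≈0 (- ((x - y) * (x - y))) (solve 3 (λ x y n →
               :- (n :* ((:- x :- (:- y)) :* (:- x :- (:- y)))) :=
               (κ 2 :* ((x :- y) :* (x :- y))) :+
               (:- ((x :- y) :* (x :- y))) :* (n :+ κ 2)) refl x y (dim m)) ⟩
        two * ((x - y) * (x - y))
          -- Parallelogram identity: (x - y)² = 2(x² + y²) - (x + y)².
          ≈⟨ modulo x²+y²≈0 (two ⊕ two) (solve 2 (λ x y →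
               κ 2 :* ((x :- y) :* (x :- y)) :=
               (:- (κ 2 :* ((x :+ y) :* (x :+ y)))) :+
               (κ 2 :+ κ 2) :* (x :* x :+ y :* y)) refl x y) ⟩
        - (two * ((x ⊕ y) * (x ⊕ y)))
          ≈⟨ modulo x+y-1≈0 (- (two * ((x ⊕ y) ⊕ 1#))) (solve 2 (λ x y →
               :- (κ 2 :* ((x :+ y) :* (x :+ y))) :=
               (:- κ 2) :+
               (:- (κ 2 :* ((x :+ y) :+ κ 1))) :* ((x :+ y) :- κ 1)) refl x y) ⟩
        - two ∎
      dist {zero} {suc (suc j)} _ = apex-frame j x+y-1≈0 x²+y²≈0
      dist {suc zero} {suc zero} (s≤s ())
      dist {suc zero} {suc (suc j)} _ = apex-frame j
        (trans (+-congʳ (+-comm y x)) x+y-1≈0) (trans (+-comm _ _) x²+y²≈0)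
      dist {suc (suc i)} {suc zero} (s≤s ())
      dist {suc (suc i)} {suc (suc j)} (s≤s (s≤s i<j)) = Q-frame-frame m i<j

    -- Now `dim m` is -3, so the apex with parameter - z has squared distance 3z² - 2z - 1 from the
    -- frame. The extra coordinate x - y corrects this to -2, because the two relations on the
    -- triple give (x - y)² = - 2z² - (1 - z)².
    oddSimplex : ∀ m {x y z} → 1# ⊕ (dim m ⊕ two) ≈ 0# → IsotropicTriple x y z →
      Σ[ P ∈ Vector (V {suc (m ℕ.* 2)}) (3 ℕ.+ m ℕ.* 2) ] IsEquilateral P
    oddSimplex m {x} {y} {z} dim+3≈0 xyz = P , equilateral-< P -two≉0 dist
      where
      point : Carrier → Carrier → Carrier → V {suc (m ℕ.* 2)}
      point x y z = x - y ∷ apex m (- z)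

      P : Vector (V {suc (m ℕ.* 2)}) (3 ℕ.+ m ℕ.* 2)
      P = point x y z ∷ point y z x ∷ point z x y ∷ λ i → 0# ∷ frame m i

      point-frame : ∀ {x y z} i → IsotropicTriple x y z →
        Q (point x y z -ⱽ (0# ∷ frame m i)) ≈ - two
      point-frame {x} {y} {z} i (sum≈1 , sq≈0) = begin
        (x - y - 0#) * (x - y - 0#) ⊕ Q (apex m (- z) -ⱽ frame m i)
          ≈⟨ +-congˡ (Q-apex-frame m (- z) i) ⟩
        (x - y - 0#) * (x - y - 0#) ⊕ ((- (dim m * (- z * - z)) ⊕ two * - z) - 1#)
          ≈⟨ modulo dim+3≈0 (- (z * z)) (solve 4 (λ x y z n →
               (x :- y :- κ 0) :* (x :- y :- κ 0) :+
                 ((:- (n :* ((:- z) :* (:- z))) :+ κ 2 :* (:- z)) :- κ 1) :=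
               ((x :- y) :* (x :- y) :+ κ 3 :* (z :* z) :- κ 2 :* z :- κ 1) :+
               (:- (z :* z)) :* (κ 1 :+ (n :+ κ 2))) refl x y z (dim m)) ⟩
        (x - y) * (x - y) ⊕ (two ⊕ 1#) * (z * z) - two * z - 1#
          ≈⟨ modulo sq≈0 two (solve 3 (λ x y z →
               (x :- y) :* (x :- y) :+ κ 3 :* (z :* z) :- κ 2 :* z :- κ 1 :=
               (z :* z :- (x :+ y) :* (x :+ y) :- κ 2 :* z :- κ 1) :+
               κ 2 :* (x :* x :+ y :* y :+ z :* z)) refl x y z) ⟩
        z * z - (x ⊕ y) * (x ⊕ y) - two * z - 1#
          ≈⟨ modulo sum≈1 (z - (x ⊕ y) - 1#) (solve 3 (λ x y z →
               z :* z :- (x :+ y) :* (x :+ y) :- κ 2 :* z :- κ 1 :=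
               (:- κ 2) :+ (z :- (x :+ y) :- κ 1) :* ((x :+ y :+ z) :- κ 1)) refl x y z) ⟩
        - two ∎

      point-point : ∀ {x y z} → IsotropicTriple x y z → Q (point x y z -ⱽ point y z x) ≈ - two
      point-point {x} {y} {z} (sum≈1 , sq≈0) = begin
        (x - y - (y - z)) * (x - y - (y - z)) ⊕ Q (apex m (- z) -ⱽ apex m (- x))
          ≈⟨ +-congˡ (Q-apex-apex m (- z) (- x)) ⟩
        (x - y - (y - z)) * (x - y - (y - z)) ⊕ - (dim m * ((- z - - x) * (- z - - x)))
          ≈⟨ modulo dim+3≈0 (- ((x - z) * (x - z))) (solve 4 (λ x y z n →
               (x :- y :- (y :- z)) :* (x :- y :- (y :- z)) :+
                 :- (n :* ((:- z :- (:- x)) :* (:- z :- (:- x)))) :=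
               ((x :- y :- (y :- z)) :* (x :- y :- (y :- z)) :+ κ 3 :* ((x :- z) :* (x :- z))) :+
               (:- ((x :- z) :* (x :- z))) :* (κ 1 :+ (n :+ κ 2))) refl x y z (dim m)) ⟩
        (x - y - (y - z)) * (x - y - (y - z)) ⊕ (two ⊕ 1#) * ((x - z) * (x - z))
          -- The expression is symmetric after all: (x - 2y + z)² + 3(x - z)² = 6(x² + y² + z²) -
          -- 2(x + y + z)².
          ≈⟨ modulo sq≈0 ((two ⊕ 1#) * two) (solve 3 (λ x y z →
               (x :- y :- (y :- z)) :* (x :- y :- (y :- z)) :+ κ 3 :* ((x :- z) :* (x :- z)) :=
               (:- (κ 2 :* ((x :+ y :+ z) :* (x :+ y :+ z)))) :+
               (κ 3 :* κ 2) :* (x :* x :+ y :* y :+ z :* z)) refl x y z) ⟩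
        - (two * ((x ⊕ y ⊕ z) * (x ⊕ y ⊕ z)))
          ≈⟨ modulo sum≈1 (- (two * ((x ⊕ y ⊕ z) ⊕ 1#))) (solve 3 (λ x y z →
               :- (κ 2 :* ((x :+ y :+ z) :* (x :+ y :+ z))) :=
               (:- κ 2) :+ (:- (κ 2 :* ((x :+ y :+ z) :+ κ 1))) :* ((x :+ y :+ z) :- κ 1)) refl x y z) ⟩
        - two ∎

      dist : ∀ {i j} → i Fin.< j → Q (P i -ⱽ P j) ≈ - two
      dist {zero} {suc zero} _ = point-point xyz
      -- The three extra points form one cycle under `rotate`, so this pair is taken in the order
      -- third, first.
      dist {zero} {suc (suc zero)} _ =
        trans (Q-sub-comm (point x y z) (point z x y)) (point-point (rotate (rotate xyz)))
      dist {zero} {suc (suc (suc j))} _ = point-frame j xyz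
      dist {suc zero} {suc (suc zero)} _ = point-point (rotate xyz)
      dist {suc zero} {suc (suc (suc j))} _ = point-frame j (rotate xyz)
      dist {suc (suc zero)} {suc (suc (suc j))} _ = point-frame j (rotate (rotate xyz))
      dist {suc (suc (suc i))} {suc (suc (suc j))} (s≤s (s≤s (s≤s i<j))) = trans
        (+-congˡ (Q-frame-frame m i<j))
        (solve 0 ((κ 0 :- κ 0) :* (κ 0 :- κ 0) :- κ 2 := :- κ 2) refl)
      dist {suc zero} {suc zero} (s≤s ())
      dist {suc (suc zero)} {suc zero} (s≤s ())
      dist {suc (suc zero)} {suc (suc zero)} (s≤s (s≤s ()))
      dist {suc (suc (suc i))} {suc zero} (s≤s ())
      dist {suc (suc (suc i))} {suc (suc zero)} (s≤s (s≤s ()))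

  -- The vector (i , 1) is isotropic, and dividing it by its coordinate sum normalises that sum to
  -- 1. The divisor is nonzero, since i = -1 would give i² + 1 = 2.
  isotropicPair : two ≉ 0# → (∃ λ i → i * i ⊕ 1# ≈ 0#) →
    ∃₂ λ x y → (x ⊕ y) - 1# ≈ 0# × x * x ⊕ y * y ≈ 0#
  isotropicPair two≉0 (i , i²+1≈0) = w * i , w ,
    trans (solve 2 (λ w i → (w :* i :+ w) :- κ 1 := w :* (i :+ κ 1) :- κ 1) refl w i)
      (≈⇒-‿zero (⁻¹-inverseˡ i+1≉0)) ,
    trans (solve 2 (λ w i → (w :* i) :* (w :* i) :+ w :* w := (w :* w) :* (i :* i :+ κ 1)) refl w i)
      (trans (*-congˡ i²+1≈0) (zeroʳ _))
    where
    w = (i ⊕ 1#) ⁻¹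
    i+1≉0 : i ⊕ 1# ≉ 0#
    i+1≉0 i+1≈0 = two≉0 (trans
      (modulo i+1≈0 (- (i - 1#)) (solve 1 (λ i →
        κ 2 := (i :* i :+ κ 1) :+ (:- (i :- κ 1)) :* (i :+ κ 1)) refl i))
      i²+1≈0)

  rescale : ∀ {a b} → (a * a ⊕ b * b) ⊕ 1# ≈ 0# → a ⊕ b ⊕ 1# ≉ 0# →
    ∃₂ λ x y → ∃ λ z → IsotropicTriple x y z
  rescale {a} {b} a²+b²+1≈0 a+b+1≉0 = w * a , w * b , w ,
    trans (solve 3 (λ w a b → (w :* a :+ w :* b :+ w) :- κ 1 :=
        w :* (a :+ b :+ κ 1) :- κ 1) refl w a b)
      (≈⇒-‿zero (⁻¹-inverseˡ a+b+1≉0)) ,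
    trans (solve 3 (λ w a b → (w :* a) :* (w :* a) :+ (w :* b) :* (w :* b) :+ w :* w :=
        (w :* w) :* ((a :* a :+ b :* b) :+ κ 1)) refl w a b)
      (trans (*-congˡ a²+b²+1≈0) (zeroʳ _))
    where w = (a ⊕ b ⊕ 1#) ⁻¹

  -- The coordinate sums of (a , b , 1) and (- a , - b , 1) add up to 2, so at least one of them can
  -- be divided by.
  isotropicTriple : two ≉ 0# → ∀ {a b} → (a * a ⊕ b * b) ⊕ 1# ≈ 0# →
    ∃₂ λ x y → ∃ λ z → IsotropicTriple x y z
  isotropicTriple two≉0 {a} {b} h with zero? (a ⊕ b ⊕ 1#)
  ... | inj₂ ≉0 = rescale h ≉0
  ... | inj₁ ≈0 = rescale
    (trans (solve 2 (λ a b → (:- a :* :- a :+ :- b :* :- b) :+ κ 1 := (a :* a :+ b :* b) :+ κ 1) refl a b) h)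
    (λ ≈0′ → two≉0 (begin
      two                                     ≈⟨ solve 2 (λ a b → κ 2 := (a :+ b :+ κ 1) :+ (:- a :+ :- b :+ κ 1)) refl a b ⟩
      (a ⊕ b ⊕ 1#) ⊕ (- a ⊕ - b ⊕ 1#)         ≈⟨ +-cong ≈0 ≈0′ ⟩
      0# ⊕ 0#                                 ≈⟨ +-identityˡ 0# ⟩
      0#                                      ∎))

  EquilateralSimplex : ℕ → Set (c ⊔ ℓ)
  EquilateralSimplex d = Σ[ P ∈ Vector (V {d}) (2 ℕ.+ d) ] IsEquilateral P

  evenDim-equilateral : two ≉ 0# → ∀ m → (2 ℕ.+ m ℕ.* 2) · 1# ≈ 0# → (∃ λ i → i * i ⊕ 1# ≈ 0#) →
    (∃₂ λ a b → (a * a ⊕ b * b) ⊕ 1# ≈ 0#) → EquilateralSimplex (m ℕ.* 2)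
  evenDim-equilateral two≉0 m 2+d≈0 √-1 (a , b , h) =
    let x , y , x+y≈1 , x²+y²≈0 = isotropicPair two≉0 √-1 in
    Simplex.evenSimplex two≉0 a b h m (trans
      (solve 1 (λ n → n :+ κ 2 := κ 1 :+ (κ 1 :+ n)) refl (dim m)) 2+d≈0)
      x+y≈1 x²+y²≈0

  oddDim-equilateral : two ≉ 0# → ∀ m → (3 ℕ.+ m ℕ.* 2) · 1# ≈ 0# →
    (∃₂ λ a b → (a * a ⊕ b * b) ⊕ 1# ≈ 0#) → EquilateralSimplex (suc (m ℕ.* 2))
  oddDim-equilateral two≉0 m 2+d≈0 (a , b , h) =
    let x , y , z , xyz = isotropicTriple two≉0 h in
    Simplex.oddSimplex two≉0 a b h m (trans
      (solve 1 (λ n → κ 1 :+ (n :+ κ 2) := κ 1 :+ (κ 1 :+ (κ 1 :+ n))) refl (dim m)) 2+d≈0)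
      xyz

  equilateral-exists : Odd q → ∀ {d} → (2 ℕ.+ d) · 1# ≈ 0# → Odd d ⊎ q ℕ.% 4 ≡ 1 → EquilateralSimplex d
  equilateral-exists q-odd {d} 2+d≈0 odd⊎1mod4 with halve d
  ... | inj₂ (m , ≡.refl) = oddDim-equilateral (two≉0 q-odd) m 2+d≈0 -1-sumOfTwoSquares
  ... | inj₁ (m , ≡.refl) = evenDim-equilateral (two≉0 q-odd) m 2+d≈0
    (-1-square q-odd ([ (λ odd → ⊥-elim (odd (divides-refl m))) , id ]′ odd⊎1mod4)) -1-sumOfTwoSquares

  -- The form on combinations of equidistant points with coefficient sum 0.

  module _ {d n : ℕ} (P : Vector (V {d}) n) where

    combine : Vector Carrier n → V {d}
    combine c k = sum (λ i → c i * P i k)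

  infix 7 _∙_
  _∙_ : ∀ {d} → V {d} → V {d} → Carrier
  x ∙ y = sum (λ k → x k * y k)

  sum-zip : ∀ {n} (f g h : Vector Carrier n) → (∀ i → f i ≈ g i ⊕ h i) → sum f ≈ sum g ⊕ sum h
  sum-zip f g h eq = trans (sum-cong-≋ eq) (∑-distrib-+ g h)

  combine-∙ : ∀ {d n} (P : Vector (V {d}) n) c y → combine P c ∙ y ≈ sum (λ i → c i * (P i ∙ y))
  combine-∙ {d} {n} P c y = begin
    sum (λ k → sum (λ i → c i * P i k) * y k)     ≈⟨ sum-cong-≋ (λ k → *-distribʳ-sum (y k) (λ i → c i * P i k)) ⟩
    sum (λ k → sum (λ i → (c i * P i k) * y k))   ≈⟨ ∑-comm (λ k i → (c i * P i k) * y k) ⟩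
    sum (λ i → sum (λ k → (c i * P i k) * y k))   ≈⟨ sum-cong-≋ (λ i → sum-cong-≋ (λ k → *-assoc (c i) (P i k) (y k))) ⟩
    sum (λ i → sum (λ k → c i * (P i k * y k)))   ≈⟨ sum-cong-≋ (λ i → *-distribˡ-sum (c i) (λ k → P i k * y k)) ⟨
    sum (λ i → c i * (P i ∙ y))                   ∎

  ∙-comm : ∀ {d} (x y : V {d}) → x ∙ y ≈ y ∙ x
  ∙-comm x y = sum-cong-≋ (λ k → *-comm (x k) (y k))

  polarisation : ∀ {d} (x y : V {d}) → two * (x ∙ y) ⊕ Q (x -ⱽ y) ≈ Q x ⊕ Q y
  polarisation x y = begin
    two * (x ∙ y) ⊕ Q (x -ⱽ y)  ≈⟨ +-congʳ (*-distribˡ-sum two (λ k → x k * y k)) ⟩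
    sum (λ k → two * (x k * y k)) ⊕ Q (x -ⱽ y)
      ≈⟨ ∑-distrib-+ (λ k → two * (x k * y k)) (λ k → (x k - y k) * (x k - y k)) ⟨
    sum (λ k → two * (x k * y k) ⊕ (x k - y k) * (x k - y k))
      ≈⟨ sum-zip _ (λ k → x k * x k) (λ k → y k * y k) (λ k → solve 2 (λ x y →
           κ 2 :* (x :* y) :+ (x :- y) :* (x :- y) := x :* x :+ y :* y) refl (x k) (y k)) ⟩
    Q x ⊕ Q y ∎

  sum-off-point : ∀ {n} (c : Vector Carrier n) {f : Vector Carrier n} {Δ} j →
    f j ≈ 0# → (∀ i → i ≢ j → f i ≈ Δ) → sum (λ i → c i * f i) ⊕ c j * Δ ≈ sum c * Δ
  sum-off-point {suc n} c {f} {Δ} j fj≈0 f≈Δ = begin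
    sum (λ i → c i * f i) ⊕ c j * Δ
      ≈⟨ +-congʳ (sum-remove {i = j} (λ i → c i * f i)) ⟩
    (c j * f j ⊕ sum (λ i → c (punchIn j i) * f (punchIn j i))) ⊕ c j * Δ
      ≈⟨ +-congʳ (+-cong (*-congˡ fj≈0)
           (sum-cong-≋ (λ i → *-congˡ (f≈Δ (punchIn j i) (Fin.punchInᵢ≢i j i))))) ⟩
    (c j * 0# ⊕ sum (λ i → c (punchIn j i) * Δ)) ⊕ c j * Δ
      ≈⟨ +-congʳ (+-congˡ (*-distribʳ-sum Δ (c ∘ punchIn j))) ⟨
    (c j * 0# ⊕ sum (c ∘ punchIn j) * Δ) ⊕ c j * Δ
      ≈⟨ solve 3 (λ s c Δ → (c :* κ 0 :+ s :* Δ) :+ c :* Δ := (c :+ s) :* Δ) refl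
           (sum (c ∘ punchIn j)) (c j) Δ ⟩
    (c j ⊕ sum (c ∘ punchIn j)) * Δ
      ≈⟨ *-congʳ (sum-remove {i = j} c) ⟨
    sum c * Δ ∎

  module _ {d n : ℕ} (P : Vector (V {d}) n) {Δ : Carrier}
           (dist : ∀ i j → i ≢ j → Q (P i -ⱽ P j) ≈ Δ)
           (c : Vector Carrier n) (Σc≈0 : sum c ≈ 0#) where

    weighted-distances : ∀ j → sum (λ i → c i * Q (P i -ⱽ P j)) ≈ - (c j * Δ)
    weighted-distances j = -‿zero⇒≈ (begin
      sum (λ i → c i * Q (P i -ⱽ P j)) - - (c j * Δ)   ≈⟨ +-congˡ (-‿involutive _) ⟩
      sum (λ i → c i * Q (P i -ⱽ P j)) ⊕ c j * Δ       ≈⟨ sum-off-point c j Q-self (λ i → dist i j) ⟩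
      sum c * Δ                                        ≈⟨ *-congʳ Σc≈0 ⟩
      0# * Δ                                           ≈⟨ zeroˡ Δ ⟩
      0#                                               ∎)
      where
      Q-self : Q (P j -ⱽ P j) ≈ 0#
      Q-self = trans (Q-cong (λ k → -‿inverseʳ (P j k))) (Q-0 d)

    -- Polarisation replaces 2 Pᵢ · Pⱼ by Q Pᵢ + Q Pⱼ - Q (Pᵢ - Pⱼ). The middle term is constant in
    -- i and dies because the coefficients sum to 0; the first leaves a quantity that does not
    -- depend on `j`.
    combine-∙-point : ∀ j → two * (combine P c ∙ P j) ≈ sum (λ i → c i * Q (P i)) ⊕ c j * Δ
    combine-∙-point j = begin
      two * (combine P c ∙ P j)
        ≈⟨ *-congˡ (combine-∙ P c (P j)) ⟩
      two * sum (λ i → c i * (P i ∙ P j))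
        ≈⟨ *-distribˡ-sum two (λ i → c i * (P i ∙ P j)) ⟩
      sum (λ i → two * (c i * (P i ∙ P j)))
        ≈⟨ sum-zip _ (λ i → c i * Q (P i) ⊕ c i * Q (P j)) (λ i → - 1# * (c i * Q (P i -ⱽ P j))) (λ i → begin
             two * (c i * (P i ∙ P j))
               ≈⟨ solve 3 (λ c b D → κ 2 :* (c :* b) := c :* (κ 2 :* b :+ D) :- c :* D)
                    refl (c i) (P i ∙ P j) (Q (P i -ⱽ P j)) ⟩
             c i * (two * (P i ∙ P j) ⊕ Q (P i -ⱽ P j)) - c i * Q (P i -ⱽ P j)
               ≈⟨ +-cong (trans (*-congˡ (polarisation (P i) (P j))) (distribˡ _ _ _)) (sym (-1*x≈-x _)) ⟩
             (c i * Q (P i) ⊕ c i * Q (P j)) ⊕ - 1# * (c i * Q (P i -ⱽ P j)) ∎) ⟩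
      sum (λ i → c i * Q (P i) ⊕ c i * Q (P j)) ⊕ sum (λ i → - 1# * (c i * Q (P i -ⱽ P j)))
        ≈⟨ +-cong (∑-distrib-+ (λ i → c i * Q (P i)) (λ i → c i * Q (P j)))
                  (sym (*-distribˡ-sum (- 1#) (λ i → c i * Q (P i -ⱽ P j)))) ⟩
      (G ⊕ sum (λ i → c i * Q (P j))) ⊕ - 1# * sum (λ i → c i * Q (P i -ⱽ P j))
        ≈⟨ +-cong (+-congˡ (trans (sym (*-distribʳ-sum (Q (P j)) c)) (*-congʳ Σc≈0))) (*-congˡ (weighted-distances j)) ⟩
      (G ⊕ 0# * Q (P j)) ⊕ - 1# * - (c j * Δ)
        ≈⟨ solve 3 (λ G q x → (G :+ κ 0 :* q) :+ (:- κ 1) :* (:- x) := G :+ x) refl G (Q (P j)) (c j * Δ) ⟩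
      G ⊕ c j * Δ ∎
      where G = sum (λ i → c i * Q (P i))

    -- Pairing `combine-∙-point` with `c` once more kills the part independent of `j`, again because
    -- the coefficients sum to 0.
    Q-combine : two * Q (combine P c) ≈ sum (λ i → c i * c i) * Δ
    Q-combine = begin
      two * (combine P c ∙ combine P c)
        ≈⟨ *-congˡ (combine-∙ P c (combine P c)) ⟩
      two * sum (λ j → c j * (P j ∙ combine P c))
        ≈⟨ *-distribˡ-sum two (λ j → c j * (P j ∙ combine P c)) ⟩
      sum (λ j → two * (c j * (P j ∙ combine P c)))
        ≈⟨ sum-zip _ (λ j → c j * G) (λ j → (c j * c j) * Δ) (λ j → begin
             two * (c j * (P j ∙ combine P c))
               ≈⟨ *-congˡ (*-congˡ (∙-comm (P j) (combine P c))) ⟩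
             two * (c j * (combine P c ∙ P j))
               ≈⟨ solve 2 (λ c b → κ 2 :* (c :* b) := c :* (κ 2 :* b)) refl (c j) (combine P c ∙ P j) ⟩
             c j * (two * (combine P c ∙ P j))
               ≈⟨ *-congˡ (combine-∙-point j) ⟩
             c j * (G ⊕ c j * Δ)
               ≈⟨ solve 3 (λ c G Δ → c :* (G :+ c :* Δ) := c :* G :+ (c :* c) :* Δ) refl (c j) G Δ ⟩
             c j * G ⊕ (c j * c j) * Δ ∎) ⟩
      sum (λ j → c j * G) ⊕ sum (λ j → (c j * c j) * Δ)
        ≈⟨ +-cong (trans (sym (*-distribʳ-sum G c)) (trans (*-congʳ Σc≈0) (zeroˡ G)))
                  (sym (*-distribʳ-sum Δ (λ j → c j * c j))) ⟩
      0# ⊕ sum (λ j → c j * c j) * Δ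
        ≈⟨ +-identityˡ _ ⟩
      sum (λ j → c j * c j) * Δ ∎
      where G = sum (λ i → c i * Q (P i))

  -- Subset sums, their distances and their number.

  indicator : ∀ {n k} → Comb n k → Vector Carrier n
  indicator (take I) = 1# ∷ indicator I
  indicator (skip I) = 0# ∷ indicator I

  sum-indicator : ∀ {n k} (I : Comb n k) → sum (indicator I) ≈ k · 1#
  sum-indicator []       = refl
  sum-indicator (take I) = +-congˡ (sum-indicator I)
  sum-indicator (skip I) = trans (+-identityˡ _) (sum-indicator I)

  sum-indicator-sub : ∀ {n k} (I J : Comb n k) → sum (λ i → indicator I i - indicator J i) ≈ 0#
  sum-indicator-sub {n} {k} I J = +-identityˡ-unique _ (k · 1#) (begin
    sum (λ i → indicator I i - indicator J i) ⊕ k · 1#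
      ≈⟨ +-congˡ (sum-indicator J) ⟨
    sum (λ i → indicator I i - indicator J i) ⊕ sum (indicator J)
      ≈⟨ sum-zip (indicator I) (λ i → indicator I i - indicator J i) (indicator J)
           (λ i → solve 2 (λ x y → x := (x :- y) :+ y) refl (indicator I i) (indicator J i)) ⟨
    sum (indicator I)
      ≈⟨ sum-indicator I ⟩
    k · 1# ∎)

  -- Here `Q` acts on coefficient vectors with entries 0 and ± 1, so it counts the symmetric
  -- difference.
  Q-indicator-sub : ∀ {n k l} (I : Comb n k) (J : Comb n l) →
    Q (indicator I -ⱽ indicator J) ≈ (∣ I ∖ J ∣ ℕ.+ ∣ J ∖ I ∣) · 1#
  Q-indicator-sub []       []       = refl
  Q-indicator-sub (take I) (take J) = trans
    (solve 1 (λ s → (κ 1 :- κ 1) :* (κ 1 :- κ 1) :+ s := s) refl _) (Q-indicator-sub I J)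
  Q-indicator-sub (take I) (skip J) = trans
    (solve 1 (λ s → (κ 1 :- κ 0) :* (κ 1 :- κ 0) :+ s := κ 1 :+ s) refl _)
    (+-congˡ (Q-indicator-sub I J))
  Q-indicator-sub (skip I) (take J) = trans
    (solve 1 (λ s → (κ 0 :- κ 1) :* (κ 0 :- κ 1) :+ s := κ 1 :+ s) refl _)
    (trans (+-congˡ (Q-indicator-sub I J)) (×-congˡ (≡.sym (ℕ.+-suc ∣ I ∖ J ∣ ∣ J ∖ I ∣))))
  Q-indicator-sub (skip I) (skip J) = trans
    (solve 1 (λ s → (κ 0 :- κ 0) :* (κ 0 :- κ 0) :+ s := s) refl _) (Q-indicator-sub I J)

  ·-* : ∀ m x → (m · 1#) * x ≈ m · x
  ·-* m x = trans (×-assoc-* m 1# x) (×-congʳ m (*-identityˡ x))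

  point : ∀ {d n k} (P : Vector (V {d}) n) → Carrier → Comb n k → V {d}
  point P s I i = s * combine P (indicator I) i

  -- Two sets of equal size have a symmetric difference of 2 `∣ I ∖ J ∣` elements, and this 2
  -- cancels the one in `Q-combine`.
  Q-point-sub : ∀ {d n k} (P : Vector (V {d}) n) {Δ} → two ≉ 0# →
    (∀ i j → i ≢ j → Q (P i -ⱽ P j) ≈ Δ) → ∀ s (I J : Comb n k) →
    Q (point P s I -ⱽ point P s J) ≈ ∣ I ∖ J ∣ · ((s * s) * Δ)
  Q-point-sub P {Δ} two≉0 dist s I J = begin
    Q (point P s I -ⱽ point P s J)        ≈⟨ Q-cong point-sub ⟩
    Q (λ i → s * combine P e i)           ≈⟨ Q-scale s (combine P e) ⟩
    (s * s) * Q (combine P e)             ≈⟨ *-congˡ (*-cancelˡ two≉0 two*Q) ⟩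
    (s * s) * (t · Δ)                     ≈⟨ ×-comm-* t (s * s) Δ ⟩
    t · ((s * s) * Δ)                     ∎
    where
    t = ∣ I ∖ J ∣
    e = λ i → indicator I i - indicator J i

    point-sub : point P s I -ⱽ point P s J ≈ⱽ (λ i → s * combine P e i)
    point-sub k = begin
      s * x - s * y                ≈⟨ +-congʳ (*-congˡ (sum-zip _ (λ i → e i * P i k) (λ i → indicator J i * P i k)
                                       (λ i → solve 3 (λ a b p → a :* p := (a :- b) :* p :+ b :* p) refl
                                         (indicator I i) (indicator J i) (P i k)))) ⟩
      s * (z ⊕ y) - s * y          ≈⟨ solve 3 (λ s z y → s :* (z :+ y) :- s :* y := s :* z) refl s z y ⟩
      s * z                        ∎
      where
      x = combine P (indicator I) k
      y = combine P (indicator J) k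
      z = combine P e k

    two*Q : two * Q (combine P e) ≈ two * (t · Δ)
    two*Q = begin
      two * Q (combine P e)                     ≈⟨ Q-combine P dist e (sum-indicator-sub I J) ⟩
      Q (indicator I -ⱽ indicator J) * Δ        ≈⟨ *-congʳ (Q-indicator-sub I J) ⟩
      ((t ℕ.+ ∣ J ∖ I ∣) · 1#) * Δ              ≈⟨ *-congʳ (×-congˡ (≡.cong (t ℕ.+_) (∖-comm J I))) ⟩
      ((t ℕ.+ t) · 1#) * Δ                      ≈⟨ *-congʳ (×-homo-+ 1# t t) ⟩
      (t · 1# ⊕ t · 1#) * Δ                     ≈⟨ solve 2 (λ t Δ → (t :+ t) :* Δ := κ 2 :* (t :* Δ))
                                                     refl (t · 1#) Δ ⟩
      two * ((t · 1#) * Δ)                      ≈⟨ *-congˡ (·-* t Δ) ⟩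
      two * (t · Δ)                             ∎

  module _ {p} (char : HasCharacteristic p) {δ : Carrier} (δ≉0 : δ ≉ 0#) where

    ·≈0⇒≡0 : ∀ {m} → m ℕ.< p → m · δ ≈ 0# → m ≡ 0
    ·≈0⇒≡0 {zero}  _   _  = ≡.refl
    ·≈0⇒≡0 {suc m} m<p eq = ⊥-elim (ℕ.<⇒≱ m<p (∣⇒≤ (Equivalence.to (char (suc m))
      (*≈0⇒≈0 δ≉0 (trans (*-comm δ _) (trans (·-* (suc m) δ) eq))))))

    ·-injective-≤ : ∀ {m n} → m ℕ.≤ n → n ℕ.< p → m · δ ≈ n · δ → m ≡ n
    ·-injective-≤ {m} {n} m≤n n<p eq =
      ℕ.≤-antisym m≤n (ℕ.m∸n≡0⇒m≤n (·≈0⇒≡0 (ℕ.≤-<-trans (ℕ.m∸n≤m n m) n<p)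
        (+-identityʳ-unique (m · δ) _ (begin
          m · δ ⊕ (n ∸ m) · δ    ≈⟨ ×-homo-+ δ m (n ∸ m) ⟨
          (m ℕ.+ (n ∸ m)) · δ    ≈⟨ ×-congˡ (ℕ.m+[n∸m]≡n m≤n) ⟩
          n · δ                  ≈⟨ eq ⟨
          m · δ                  ∎))))

    ·-injective : ∀ {m n} → m ℕ.< p → n ℕ.< p → m · δ ≈ n · δ → m ≡ n
    ·-injective {m} {n} m<p n<p eq with ℕ.≤-total m n
    ... | inj₁ m≤n = ·-injective-≤ m≤n n<p eq
    ... | inj₂ n≤m = ≡.sym (·-injective-≤ n≤m m<p (sym eq))

  -- The set `S` enters through two inclusions, so that it may be the plain image of `point` as well
  -- as `EdgeMidpoints`. The bound by `p` is used twice: it separates the distances and it separates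
  -- the points.
  subsetSums : ∀ {d n k p r} → two ≉ 0# → HasCharacteristic p →
    (P : Vector (V {d}) n) → IsEquilateral P → ∀ {s} → s ≉ 0# →
    k ℕ.≤ n → k ⊓ (n ∸ k) ℕ.< p →
    (S : Pred (V {d}) r) → (∀ (I : Comb n k) → S (point P s I)) →
    (∀ {x} → S x → ∃ λ (I : Comb n k) → x ≈ⱽ point P s I) →
    IsDistanceSet (k ⊓ (n ∸ k)) S × HasCardinality S (n C k)
  subsetSums {d} {n} {k} {p} two≉0 char P (Δ , Δ≉0 , dist) {s} s≉0 k≤n ℓ<p S S-point S-only =
    -- The successor skips the multiple 0, which belongs to equal subsets.
    image-hasSize setoid (Distances S) (λ τ → suc (toℕ τ) · δ) τ-injective τ-distance τ-index ,
    image-hasSize space S (point P s ∘ from)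
      (λ eq → Injection.injective (↔⇒↣ (↔-sym (comb↔Fin n k))) (point-injective eq)) (S-point ∘ from)
      (λ Sx → let I , x≈ = S-only Sx in to I ,
        ≡.subst (λ I → _ ≈ⱽ point P s I) (≡.sym (strictlyInverseʳ I)) x≈)
    where
    open Inverse (comb↔Fin n k) using (to; from; strictlyInverseʳ)
    δ = (s * s) * Δ
    δ≉0 : δ ≉ 0#
    δ≉0 = *-≉0 (*-≉0 s≉0 s≉0) Δ≉0
    ℓ′ = k ⊓ (n ∸ k)

    ∖<p : ∀ (I J : Comb n k) → ∣ I ∖ J ∣ ℕ.< p
    ∖<p I J = ℕ.≤-<-trans (∖-≤-⊓ I J) ℓ<p

    point-injective : ∀ {I J : Comb n k} → point P s I ≈ⱽ point P s J → I ≡ J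
    -- Linear independence is no help, as there may be more points than dimensions. Instead, equal
    -- sums are at distance 0, and `∣ I ∖ J ∣` is too small to vanish in F unless it is 0.
    point-injective {I} {J} eq = ∖≡0⇒≡ I J (·≈0⇒≡0 char δ≉0 (∖<p I J) (begin
      ∣ I ∖ J ∣ · δ                       ≈⟨ Q-point-sub P two≉0 dist s I J ⟨
      Q (point P s I -ⱽ point P s J)      ≈⟨ Q-cong (λ i → ≈⇒-‿zero (eq i)) ⟩
      Q (0ⱽ {d})                          ≈⟨ Q-0 d ⟩
      0#                                  ∎))

    τ<p : ∀ (τ : Fin ℓ′) → suc (toℕ τ) ℕ.< p
    τ<p τ = ℕ.≤-<-trans (Fin.toℕ<n τ) ℓ<p

    τ-injective : ∀ {τ υ : Fin ℓ′} → suc (toℕ τ) · δ ≈ suc (toℕ υ) · δ → τ ≡ υ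
    τ-injective {τ} {υ} eq = Fin.toℕ-injective (ℕ.suc-injective (·-injective char δ≉0 (τ<p τ) (τ<p υ) eq))

    τ-distance : ∀ (τ : Fin ℓ′) → Distances S (suc (toℕ τ) · δ)
    τ-distance τ =
      let I , J , eq = ∖-attained (Fin.toℕ<n τ) k≤n
          I≢J : I ≢ J
          I≢J I≡J = ℕ.1+n≢0 (≡.trans (≡.sym eq) (≡.trans (≡.cong (λ I → ∣ I ∖ J ∣) I≡J) (∖-self J)))
      in point P s I , point P s J , S-point I , S-point J , I≢J ∘ point-injective ,
         trans (×-congˡ (≡.sym eq)) (sym (Q-point-sub P two≉0 dist s I J))

    τ-index : ∀ {ε} → Distances S ε → ∃ λ (τ : Fin ℓ′) → ε ≈ suc (toℕ τ) · δ
    τ-index {ε} (x , y , Sx , Sy , x≉y , ε≈) =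
      let I , x≈ = S-only Sx
          J , y≈ = S-only Sy
      in index I J x≈ y≈ _ ≡.refl
      where
      index : ∀ (I J : Comb n k) → x ≈ⱽ point P s I → y ≈ⱽ point P s J → ∀ t → ∣ I ∖ J ∣ ≡ t →
              ∃ λ (τ : Fin ℓ′) → ε ≈ suc (toℕ τ) · δ
      index I J x≈ y≈ zero eq = ⊥-elim (x≉y λ i → trans (x≈ i)
        (trans (reflexive (≡.cong (λ I → point P s I i) (∖≡0⇒≡ I J eq))) (sym (y≈ i))))
      index I J x≈ y≈ (suc t) eq = fromℕ< t<ℓ , (begin
        ε                                 ≈⟨ ε≈ ⟩
        Q (x -ⱽ y)                        ≈⟨ Q-cong (λ i → +-cong (x≈ i) (-‿cong (y≈ i))) ⟩
        Q (point P s I -ⱽ point P s J)    ≈⟨ Q-point-sub P two≉0 dist s I J ⟩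
        ∣ I ∖ J ∣ · δ                     ≈⟨ ×-congˡ (≡.trans eq (≡.cong suc (≡.sym (Fin.toℕ-fromℕ< t<ℓ)))) ⟩
        suc (toℕ (fromℕ< t<ℓ)) · δ        ∎)
        where
        t<ℓ : t ℕ.< ℓ′
        t<ℓ = ≡.subst (ℕ._≤ ℓ′) eq (∖-≤-⊓ I J)

  -- Two-element subsets as edges, and the edge midpoints.

  weightedSum : ∀ {n k} → Comb n k → Vector Carrier n → Carrier
  weightedSum I y = sum (λ i → indicator I i * y i)

  weightedSum-take : ∀ {n k} (I : Comb n k) y → weightedSum (take I) y ≈ y zero ⊕ weightedSum I (y ∘ suc)
  weightedSum-take I y = +-congʳ (*-identityˡ _)

  weightedSum-skip : ∀ {n k} (I : Comb n k) y → weightedSum (skip I) y ≈ weightedSum I (y ∘ suc)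
  weightedSum-skip I y = trans (+-congʳ (zeroˡ _)) (+-identityˡ _)

  weightedSum-∅ : ∀ {n} (I : Comb n 0) y → weightedSum I y ≈ 0#
  weightedSum-∅ []       y = refl
  weightedSum-∅ (skip I) y = trans (weightedSum-skip I y) (weightedSum-∅ I (y ∘ suc))

  singleton⇒point : ∀ {n} (I : Comb n 1) → ∃ λ i → ∀ y → weightedSum I y ≈ y i
  singleton⇒point (take I) = zero , λ y →
    trans (weightedSum-take I y) (trans (+-congˡ (weightedSum-∅ I (y ∘ suc))) (+-identityʳ _))
  singleton⇒point (skip I) with i , eq ← singleton⇒point I =
    suc i , λ y → trans (weightedSum-skip I y) (eq (y ∘ suc))

  point⇒singleton : ∀ {n} (i : Fin n) → ∃ λ (I : Comb n 1) → ∀ y → weightedSum I y ≈ y i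
  point⇒singleton {suc n} zero = take (skipAll n) , λ y →
    trans (weightedSum-take (skipAll n) y) (trans (+-congˡ (weightedSum-∅ (skipAll n) (y ∘ suc))) (+-identityʳ _))
  point⇒singleton {suc n} (suc i) with I , eq ← point⇒singleton i =
    skip I , λ y → trans (weightedSum-skip I y) (eq (y ∘ suc))

  -- The vector `y` is quantified inside the existential because one edge has to serve all
  -- coordinates of the points at once.
  pair⇒edge : ∀ {n} (I : Comb n 2) → ∃₂ λ i j → i Fin.< j × (∀ y → weightedSum I y ≈ y i ⊕ y j)
  pair⇒edge (take I) with j , eq ← singleton⇒point I =
    zero , suc j , s≤s z≤n , λ y → trans (weightedSum-take I y) (+-congˡ (eq (y ∘ suc)))
  pair⇒edge (skip I) with i , j , i<j , eq ← pair⇒edge I =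
    suc i , suc j , s≤s i<j , λ y → trans (weightedSum-skip I y) (eq (y ∘ suc))

  edge⇒pair : ∀ {n} {i j : Fin n} → i Fin.< j → ∃ λ (I : Comb n 2) → ∀ y → weightedSum I y ≈ y i ⊕ y j
  edge⇒pair {suc n} {zero} {suc j} _ with I , eq ← point⇒singleton j =
    take I , λ y → trans (weightedSum-take I y) (+-congˡ (eq (y ∘ suc)))
  edge⇒pair {suc n} {suc i} {suc j} (s≤s i<j) with I , eq ← edge⇒pair i<j =
    skip I , λ y → trans (weightedSum-skip I y) (eq (y ∘ suc))

  -- With at least four points there are disjoint edges as well as edges sharing a vertex, so both
  -- distances occur.
  edgeMidpoints : ∀ {d n p} → two ≉ 0# → HasCharacteristic p → 2 ℕ.< p → 4 ℕ.≤ n →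
    (P : Vector (V {d}) n) → IsEquilateral P →
    IsDistanceSet 2 (EdgeMidpoints P) × HasCardinality (EdgeMidpoints P) (n C 2)
  edgeMidpoints {d} {n} {p} two≉0 char 2<p 4≤n P equilateral =
    ≡.subst (λ ℓ → IsDistanceSet ℓ (EdgeMidpoints P)) 2⊓≡2 (proj₁ sizes) , proj₂ sizes
    where
    2⊓≡2 : 2 ⊓ (n ∸ 2) ≡ 2
    2⊓≡2 = ℕ.m≤n⇒m⊓n≡m (ℕ.∸-monoˡ-≤ 2 4≤n)
    ½≉0 : two ⁻¹ ≉ 0#
    ½≉0 eq = 1≉0 (trans (sym (⁻¹-inverseˡ two≉0)) (trans (*-congʳ eq) (zeroˡ two)))
    sizes = subsetSums two≉0 char P equilateral ½≉0 (ℕ.≤-trans (s≤s (s≤s z≤n)) 4≤n)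
      (≡.subst (ℕ._< p) (≡.sym 2⊓≡2) 2<p) (EdgeMidpoints P)
      (λ I → let i , j , i<j , eq = pair⇒edge I in
        -- A coordinate of `midpoint` is `two ⁻¹` times a sum of two coordinates, hence a coordinate
        -- of `point` with scale `two ⁻¹`.
        i , j , i<j , λ k → *-congˡ (eq (λ i → P i k)))
      (λ (i , j , i<j , x≈) → let I , eq = edge⇒pair i<j in
        I , λ k → trans (x≈ k) (*-congˡ (sym (eq (λ i → P i k)))))

  -- Provides, for pairs, the bound on the number of distances that the general statement takes as a
  -- hypothesis.
  2<char : ∀ {p d} → two ≉ 0# → HasCharacteristic p → p ∣ suc d → 2 ℕ.< p
  2<char {zero} _ _ p∣ with () ← 0∣⇒≡0 p∣
  2<char {1} _ char _ = ⊥-elim (1≉0 (trans (sym (+-identityʳ 1#)) (Equivalence.from (char 1) ∣-refl)))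
  2<char {2} two≉0 char _ = ⊥-elim (two≉0 (trans
    (+-congˡ (sym (+-identityʳ 1#))) (Equivalence.from (char 2) ∣-refl)))
  2<char {suc (suc (suc p))} _ _ _ = s≤s (s≤s (s≤s z≤n))

theorem4p6 : ∀ {c ℓ : Level} (q p d : ℕ) (F : FiniteField c ℓ q) →
    let open FiniteField F using (HasCharacteristic)
        open QuadraticSpace F d
    in
    PrimePower q → Odd q → HasCharacteristic p → 1 ≤ d →
    p ∣ d + 2 → (Odd d ⊎ q % 4 ≡ 1) →
    (∀ (k : ℕ) → 1 ≤ k → k ≤ d + 1 → k ⊓ (d + 2 ∸ k) < p →
      Σ[ S ∈ Pred V ℓ ] (S Respects _≈ⱽ_
        × IsDistanceSet (k ⊓ (d + 2 ∸ k)) S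
        × HasCardinality S ((d + 2) C k)))
    ×
    (2 ≤ d →
      Σ[ P ∈ Vector V (d + 2) ] (IsEquilateral P
        × IsDistanceSet 2 (EdgeMidpoints P)
        × HasCardinality (EdgeMidpoints P) ((d + 2) C 2)))
theorem4p6 q p d F _ q-odd char _ p∣d+2 odd⊎1mod4 = part₁ simplex , part₂ simplex
  where
  open FiniteField F using (trans; sym; 1#)
  open FieldProperties F using (two≉0; 1≉0)
  open QuadraticSpace F d
  open Geometry F using (equilateral-exists; point; subsetSums; edgeMidpoints; 2<char)

  p∣2+d : p ∣ 2 + d
  p∣2+d = ≡.subst (p ∣_) (ℕ.+-comm d 2) p∣d+2

  Simplex : Set _
  Simplex = Σ[ P ∈ Vector V (d + 2) ] IsEquilateral P

  simplex : Simplex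
  simplex = ≡.subst (λ n → Σ[ P ∈ Vector V n ] IsEquilateral P) (ℕ.+-comm 2 d)
    (equilateral-exists q-odd (Equivalence.from (char (2 + d)) p∣2+d) odd⊎1mod4)

  part₁ : Simplex → ∀ k → 1 ≤ k → k ≤ d + 1 → k ⊓ (d + 2 ∸ k) < p →
    Σ[ S ∈ Pred V _ ] (S Respects _≈ⱽ_
      × IsDistanceSet (k ⊓ (d + 2 ∸ k)) S
      × HasCardinality S ((d + 2) C k))
  part₁ (P , equilateral) k _ k≤d+1 ℓ<p =
    S , (λ x≈y (I , x≈) → I , λ i → trans (sym (x≈y i)) (x≈ i)) ,
    subsetSums (two≉0 q-odd) char P equilateral 1≉0
      (ℕ.≤-trans k≤d+1 (ℕ.+-monoʳ-≤ d (ℕ.n≤1+n 1))) ℓ<p S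
      (λ I → I , λ _ → FiniteField.refl F) (λ Sx → Sx)
    where
    S : Pred V _
    -- Taking the image up to `≈ⱽ` is what makes `S` respect the equality of the space.
    S x = Σ[ I ∈ Comb (d + 2) k ] x ≈ⱽ point P 1# I

  part₂ : Simplex → 2 ≤ d →
    Σ[ P ∈ Vector V (d + 2) ] (IsEquilateral P
      × IsDistanceSet 2 (EdgeMidpoints P)
      × HasCardinality (EdgeMidpoints P) ((d + 2) C 2))
  part₂ (P , equilateral) 2≤d = P , equilateral ,
    edgeMidpoints (two≉0 q-odd) char (2<char (two≉0 q-odd) char p∣2+d) (ℕ.+-monoˡ-≤ 2 2≤d) P equilateral
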